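{- For $w>0$, the graphic generating function of directed acyclic graphs satisfies, as an identity of formal power series in $z$, \[u\,\partial_u \mathrm{DAG}(z,w,u)=u z\,\mathrm{DAG}\!\left(\frac{z}{1+w},w,u\right)\mathrm{DAG}\!\left(z,w,\frac{w}{1+w}\right).\]
   Context: For a labelled DAG $G$ (directed acyclic graph on vertex set $\{1,\dots,n\}$, $n\ge0$), $v(G)$, $e(G)$, $s(G)$ denote its numbers of vertices, edges, and sources (vertices of in-degree $0$). $\mathrm{DAG}(z,w,u)=\sum_G \frac{z^{v(G)}w^{e(G)}u^{s(G)}}{(1+w)^{\binom{v(G)}{2}}v(G)!}$, the sum over all labelled DAGs. (It is known that $\mathrm{DAG}(z,w,u)=\mathrm{Set}((u-1)z,w)/\mathrm{Set}(-z,w)$ with $\mathrm{Set}(z,w)=\sum_{n\ge0}\frac{z^n}{(1+w)^{\binom n2}n!}$.) -}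

module Defs where

open import Algebra.Apartness.Bundles using (HeytingField; HeytingCommutativeRing)
open import Algebra.Bundles using (CommutativeRing; RawSemiring; Semiring)
import Algebra.Definitions.RawSemiring as RawSemiringDefinitions
import Algebra.Properties.Ring as RingProperties
open import Data.Fin.Base as Fin using (Fin; zero; suc; toℕ)
open import Data.Fin.Properties using (any?; pigeonhole)
open import Data.Fin.Subset using (Subset; _∈_; ∣_∣; inside; outside)
open import Data.Fin.Subset.Properties using (_∈?_)
open import Data.List.Base as List using (List; []; _∷_; cartesianProductWith; filter)
open import Data.Nat.Base as ℕ using (ℕ; zero; suc; _∸_; _!; z<s; s<s)
open import Data.Nat.Combinatorics using (_C_)
import Data.Nat.Properties as ℕ
open import Data.Product.Base using (∃; _×_; _,_; proj₁; proj₂)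
open import Data.Sum.Base using (_⊎_; inj₁; inj₂)
open import Data.Unit.Base using (⊤; tt)
open import Data.Vec.Base as Vec using (Vec; lookup)
open import Function.Base using (_∘_)
open import Function.Bundles using (_⇔_; Equivalence)
open import Level using (_⊔_)
open import Relation.Binary.Construct.Closure.Transitive using (TransClosure; [_]; _∷_)
open import Relation.Binary.Core using (Rel)
open import Relation.Binary.PropositionalEquality.Core using (subst) renaming (sym to ≡-sym)
open import Relation.Binary.Structures using (IsStrictPartialOrder)
open import Relation.Nullary using (¬_; Dec; yes)
open import Relation.Nullary.Decidable using (map′; ¬?; _×-dec_)
open import Relation.Unary using (Decidable)

------------------------------------------------------------------------
-- Ordered fields

-- The order is not assumed to be decidable, so that the real numbers
-- are an ordered field in this sense both classically (with # the
-- negation of ≈) and constructively.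

record OrderedField c ℓ₁ ℓ₂ ℓ₃ : Set (Level.suc (c ⊔ ℓ₁ ⊔ ℓ₂ ⊔ ℓ₃)) where
  field
    heytingField : HeytingField c ℓ₁ ℓ₂

  open HeytingField heytingField public

  infix 4 _<_

  field
    _<_                  : Rel Carrier ℓ₃
    isStrictPartialOrder : IsStrictPartialOrder _≈_ _<_
    #⇔<⊎>                : ∀ {x y} → x # y ⇔ (x < y ⊎ y < x)
    +-monoˡ-<            : ∀ z {x y} → x < y → x + z < y + z
    *-pos                : ∀ {x y} → 0# < x → 0# < y → 0# < x * y

  commutativeRing : CommutativeRing c ℓ₁
  commutativeRing = HeytingCommutativeRing.commutativeRing heytingCommutativeRing

  open RawSemiringDefinitions (Semiring.rawSemiring (CommutativeRing.semiring commutativeRing)) public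
    using (_^_) renaming (_×_ to _·_)

  open IsStrictPartialOrder isStrictPartialOrder public
    using (<-respˡ-≈; <-respʳ-≈)
    renaming (trans to <-trans; irrefl to <-irrefl)

  private
    module RP = RingProperties (CommutativeRing.ring commutativeRing)

    0<⇒#0 : ∀ {x} → 0# < x → x # 0#
    0<⇒#0 0<x = Equivalence.from #⇔<⊎> (inj₂ 0<x)

    x-0≈x : ∀ x → x - 0# ≈ x
    x-0≈x x = trans (+-congˡ RP.-0#≈0#) (+-identityʳ x)

  recip : ∀ x → 0# < x → Carrier
  recip x 0<x = proj₁ (#⇒invertible (0<⇒#0 0<x))

  recip-inverseˡ : ∀ x (0<x : 0# < x) → recip x 0<x * x ≈ 1#
  recip-inverseˡ x 0<x = trans (*-congˡ (sym (x-0≈x x)))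
    (proj₁ (proj₂ (#⇒invertible (0<⇒#0 0<x))))

  1#0 : 1# # 0#
  1#0 = invertible⇒#
    (1# , trans (*-identityˡ _) (x-0≈x 1#) , trans (*-identityʳ _) (x-0≈x 1#))

  0<1 : 0# < 1#
  0<1 with Equivalence.to #⇔<⊎> 1#0
  ... | inj₂ 0<1 = 0<1
  ... | inj₁ 1<0 = <-respʳ-≈ -1*-1≈1 (*-pos 0<-1 0<-1)
    where
    0<-1 : 0# < - 1#
    0<-1 = <-respˡ-≈ (-‿inverseʳ 1#) (<-respʳ-≈ (+-identityˡ _) (+-monoˡ-< (- 1#) 1<0))

    -1*-1≈1 : - 1# * - 1# ≈ 1#
    -1*-1≈1 = trans (RP.-1*x≈-x (- 1#)) (RP.-‿involutive 1#)

  +-pos : ∀ {x y} → 0# < x → 0# < y → 0# < x + y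
  +-pos {x} {y} 0<x 0<y =
    <-trans 0<y (<-respˡ-≈ (+-identityˡ y) (+-monoˡ-< y 0<x))

  ^-pos : ∀ {x} → 0# < x → ∀ n → 0# < x ^ n
  ^-pos 0<x zero    = 0<1
  ^-pos 0<x (suc n) = *-pos 0<x (^-pos 0<x n)

  ·-pos : ∀ {x} → 0# < x → ∀ {n} → 0 ℕ.< n → 0# < n · x
  ·-pos {x} 0<x {suc zero}    _ = <-respʳ-≈ (sym (+-identityʳ x)) 0<x
  ·-pos     0<x {suc (suc n)} _ = +-pos 0<x (·-pos 0<x {suc n} z<s)

------------------------------------------------------------------------
-- Polynomials in one variable

module Polynomial {c ℓ} (R : CommutativeRing c ℓ) where
  open CommutativeRing R using (Carrier; _≈_; _+_; _*_; 0#; 1#; semiring)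
  open RawSemiringDefinitions (Semiring.rawSemiring semiring) using () renaming (_×_ to _·_)

  -- Coefficients in order of increasing degree; trailing zeros are
  -- allowed, and disregarded by _≈ₚ_.

  Poly : Set c
  Poly = List Carrier

  coeff : Poly → ℕ → Carrier
  coeff []      _       = 0#
  coeff (a ∷ p) zero    = a
  coeff (a ∷ p) (suc k) = coeff p k

  infix  4 _≈ₚ_
  infixl 6 _+ₚ_
  infixl 7 _*ₚ_

  _≈ₚ_ : Rel Poly ℓ
  p ≈ₚ q = ∀ k → coeff p k ≈ coeff q k

  _+ₚ_ : Poly → Poly → Poly
  []      +ₚ q       = q
  (a ∷ p) +ₚ []      = a ∷ p
  (a ∷ p) +ₚ (b ∷ q) = (a + b) ∷ (p +ₚ q)

  _*ₚ_ : Poly → Poly → Poly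
  []      *ₚ q = []
  (a ∷ p) *ₚ q = List.map (a *_) q +ₚ (0# ∷ (p *ₚ q))

  constₚ : Carrier → Poly
  constₚ a = a ∷ []

  X : Poly
  X = 0# ∷ 1# ∷ []

  derivative : Poly → Poly
  derivative []      = []
  derivative (_ ∷ p) = List.zipWith _·_ (List.applyUpTo suc (List.length p)) p

  polyRawSemiring : RawSemiring c ℓ
  polyRawSemiring = record
    { Carrier = Poly
    ; _≈_     = _≈ₚ_
    ; _+_     = _+ₚ_
    ; _*_     = _*ₚ_
    ; 0#      = []
    ; 1#      = constₚ 1#
    }

------------------------------------------------------------------------
-- Formal power series in one variable z

module PowerSeries {c ℓ} (R : RawSemiring c ℓ) where
  open RawSemiring R
  open RawSemiringDefinitions R using (_^_; sum)

  Series : Set c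
  Series = ℕ → Carrier

  infix  4 _≋_
  infixl 7 _⊛_

  _≋_ : Rel Series ℓ
  f ≋ g = ∀ n → f n ≈ g n

  _⊛_ : Series → Series → Series
  (f ⊛ g) n = sum {suc n} (λ i → f (toℕ i) * g (n ∸ toℕ i))

  constant : Carrier → Series
  constant a zero    = a
  constant a (suc _) = 0#

  z : Series
  z zero          = 0#
  z (suc zero)    = 1#
  z (suc (suc _)) = 0#

  -- f ⟨ a z⟩ is the result of substituting a z for z in f.

  infix 8 _⟨_z⟩

  _⟨_z⟩ : Series → Carrier → Series
  (f ⟨ a z⟩) n = a ^ n * f n

------------------------------------------------------------------------
-- Labelled directed acyclic graphs

-- Row i of the adjacency matrix is the set of out-neighbours of i.
-- Loops are representable, but excluded by acyclicity.

Digraph : ℕ → Set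
Digraph n = Vec (Subset n) n

module _ {n : ℕ} (G : Digraph n) where

  Edge : Rel (Fin n) _
  Edge i j = j ∈ lookup G i

  Acyclic : Set
  Acyclic = ∀ i → ¬ TransClosure Edge i i

  edges : ℕ
  edges = Vec.sum (Vec.map ∣_∣ G)

  inNeighbours : Fin n → Subset n
  inNeighbours j = Vec.map (λ row → lookup row j) G

  inDegree : Fin n → ℕ
  inDegree j = ∣ inNeighbours j ∣

  sources : ℕ
  sources = Vec.count (λ j → inDegree j ℕ.≟ 0) (Vec.allFin n)

-- A digraph on n vertices is acyclic precisely when it has no walk with
-- n edges, by the pigeonhole principle; this makes acyclicity decidable.

module _ {n : ℕ} (G : Digraph n) where

  private
    Walk : ℕ → Fin n → Set
    Walk zero    i = ⊤
    Walk (suc k) i = ∃ λ j → Edge G i j × Walk k j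

    walk? : ∀ k → Decidable (Walk k)
    walk? zero    i = yes tt
    walk? (suc k) i = any? λ j → (j ∈? lookup G i) ×-dec walk? k j

    vertex : ∀ k {i} → Walk k i → Fin (suc k) → Fin n
    vertex _       {i} _           zero    = i
    vertex (suc k)     (_ , _ , w) (suc a) = vertex k w a

    connected : ∀ k {i} (w : Walk k i) {a b} → a Fin.< b →
                TransClosure (Edge G) (vertex k w a) (vertex k w b)
    connected (suc k) (_ , e , w) {zero}  {suc zero}    _         = [ e ]
    connected (suc (suc k)) (_ , e , w) {zero}  {suc (suc b)} _   =
      e ∷ connected (suc k) w {zero} {suc b} z<s
    connected (suc k) (_ , e , w) {suc a} {suc b}       (s<s a<b) =
      connected k w a<b

    walk⇒cycle : ∀ {i} → Walk n i → ∃ λ j → TransClosure (Edge G) j j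
    walk⇒cycle w =
      let a , b , a<b , eq = pigeonhole (ℕ.n<1+n n) (vertex n w)
      in vertex n w a ,
         subst (TransClosure (Edge G) _) (≡-sym eq) (connected n w a<b)

    cycle⇒walk : ∀ {i} → TransClosure (Edge G) i i → ∀ k {j} →
                 TransClosure (Edge G) j i → Walk k j
    cycle⇒walk c zero    _       = tt
    cycle⇒walk c (suc k) [ e ]   = _ , e , cycle⇒walk c k c
    cycle⇒walk c (suc k) (e ∷ p) = _ , e , cycle⇒walk c k p

  acyclic? : Dec (Acyclic G)
  acyclic? = map′
    (λ ¬w i c → ¬w (i , cycle⇒walk c n c))
    (λ acyclic (_ , w) → let j , c = walk⇒cycle w in acyclic j c)
    (¬? (any? (walk? n)))

vectors : ∀ {a} {A : Set a} → List A → ∀ n → List (Vec A n)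
vectors xs zero    = Vec.[] ∷ []
vectors xs (suc n) = cartesianProductWith Vec._∷_ xs (vectors xs n)

digraphs : ∀ n → List (Digraph n)
digraphs n = vectors (vectors (outside ∷ inside ∷ []) n) n

dags : ∀ n → List (Digraph n)
dags n = filter acyclic? (digraphs n)

------------------------------------------------------------------------
-- The graphic generating function of directed acyclic graphs

module GraphicGeneratingFunction {c ℓ₁ ℓ₂ ℓ₃} (F : OrderedField c ℓ₁ ℓ₂ ℓ₃)
  (w : OrderedField.Carrier F)
  (0<w : OrderedField._<_ F (OrderedField.0# F) w)
  where

  open OrderedField F
  open Polynomial commutativeRing public
  open PowerSeries polyRawSemiring public
  open RawSemiringDefinitions polyRawSemiring using () renaming (_^_ to _^ₚ_)

  0<1+w : 0# < 1# + w
  0<1+w = +-pos 0<1 0<w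

  1/[1+w] : Carrier
  1/[1+w] = recip (1# + w) 0<1+w

  denominator : ℕ → Carrier
  denominator n = (1# + w) ^ (n C 2) * ((n !) · 1#)

  0<denominator : ∀ n → 0# < denominator n
  0<denominator n = *-pos (^-pos 0<1+w (n C 2)) (·-pos 0<1 (ℕ.1≤n! n))

  -- DAG t is DAG(z,w,t) as a power series in z over polynomials in u.
  -- Here t may be any such polynomial: the variable u itself, or a
  -- constant.

  DAG : Poly → Series
  DAG t n = List.foldr _+ₚ_ []
    (List.map (λ G → constₚ (w ^ edges G * recip (denominator n) (0<denominator n))
                     *ₚ t ^ₚ sources G)
              (dags n))

  u : Poly
  u = X

  ∂ᵤ : Series → Series
  ∂ᵤ f n = derivative (f n)

-- Write D(t) for DAG(z,w,t) and σ(t) = (t + w)/(1 + w).  Deleting a marked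
-- source i from a DAG leaves a smaller DAG G together with an arbitrary set of
-- out-neighbours of i.  A source of G contributes t if it is not an
-- out-neighbour of i and w if it is, any other vertex contributes 1 or w, so
-- that summing over the set of out-neighbours turns t into σ(t):
--
--   ∂D(t) = ∂t · z D(σ(t)).
--
-- It remains to show that D(σ(u)) = DAG(z/(1+w),w,u) DAG(z,w,w/(1+w)).  Both
-- sides agree at u = 0, where σ(0) = w/(1+w) and DAG(z,w,0) = 1, because every
-- nonempty DAG has a source.  By the formula above, if the identity holds for
-- the coefficient of zⁿ, then (substituting σ(u) for u in it) the derivatives
-- of the coefficients of zⁿ⁺¹ agree too; in characteristic 0 this suffices.

module Submission where

open import Defs
open import Algebra.Bundles using (CommutativeRing; CommutativeSemiring; Semiring)
import Algebra.Definitions.RawSemiring as RawSemiringDefinitions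
open import Data.Bool.Base using (Bool; true; false; if_then_else_; not; _∧_)
import Data.Bool.Properties as Bool
open import Data.Fin.Base as Fin using (Fin; zero; suc; toℕ; punchIn; punchOut)
import Data.Fin.Properties as Fin
open import Data.Fin.Subset using (Subset; ∣_∣; inside; outside)
open import Data.Fin.Subset.Properties using (∣⊥∣≡0)
open import Data.List.Base as List using (List; []; _∷_; _++_; filter; cartesianProductWith)
open import Data.Nat.Base as ℕ using (ℕ; zero; suc; _∸_; _!)
open import Data.Nat.Combinatorics using (_C_; nC1≡n; nCk+nC[k+1]≡[n+1]C[k+1])
import Data.Nat.Properties as ℕ
open import Data.Product.Base using (∃; _×_; _,_; proj₁; proj₂)
open import Data.Vec.Base as Vec using (Vec; lookup; insertAt)
open import Data.Vec.Properties
  using (insertAt-lookup; insertAt-punchIn; lookup-allFin; lookup-map; map-cong; map-const;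
         map-insertAt; map-∘; []=⇒lookup; lookup⇒[]=)
open import Function.Base using (_∘_)
open import Function.Bundles using (_⇔_; mk⇔)
open import Level using (Level)
open import Relation.Binary.Construct.Closure.Transitive using (TransClosure; [_]; _∷_)
open import Relation.Binary.PropositionalEquality as ≡ using (_≡_; _≢_; cong; cong₂; subst; subst₂)
open import Relation.Nullary using (¬_; Dec; yes; no; does; contradiction)
open import Relation.Nullary.Decidable using (does-⇔; dec-false; dec-true)
open import Relation.Unary using (Decidable)

-- The formula for ∂D(t) changes the argument of D, so it is proved for every polynomial t; it is
-- applied at t = u, at t = σ(u) and at a constant. The denominators make it free of extra factors:
-- a marked source added to a DAG on n vertices has n + 1 possible labels, the sum over its
-- out-neighbours yields 1 + w for each old vertex, and (n + 1)(1 + w)ⁿ is the quotient of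
-- consecutive denominators.
--
-- The arguments z/(1+w) and w/(1+w) are forced by σ. The slope of σ is 1/(1+w), so D(σ(u)) obeys
-- the law that the derivative of the coefficient of zⁿ⁺¹ is 1/(1+w) times the coefficient of zⁿ
-- with σ(u) substituted for u. Rescaling z by that slope makes DAG(z/(1+w),w,u) obey the same law.
-- A factor free of u preserves the law, and DAG(z,w,w/(1+w)) is the one that corrects the value at
-- u = 0.

-- The commutative semiring of polynomials

module PolynomialSemiring {c ℓ} (R : CommutativeRing c ℓ) where
  open CommutativeRing R hiding (zero)
  open Polynomial R
  open import Algebra.Solver.Ring.NaturalCoefficients.Default commutativeSemiring
  open import Relation.Binary.Reasoning.Setoid setoid

  -- _≈ₚ_ unfolds to a function type, from which Agda cannot recover the
  -- two polynomials.
  infix 4 _≅_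

  record _≅_ (p q : Poly) : Set ℓ where
    constructor coeffwise
    field
      at : p ≈ₚ q

  open _≅_ public

  -- The quotient of p - p₀ by `X`. It is total, so that proofs can recurse on the degree instead of
  -- matching lists, whose lengths may differ between equal polynomials.
  tl : Poly → Poly
  tl []      = []
  tl (_ ∷ p) = p

  scale : Carrier → Poly → Poly
  scale a = List.map (a *_)

  coeff-tl : ∀ p k → coeff (tl p) k ≡ coeff p (suc k)
  coeff-tl []      k = ≡.refl
  coeff-tl (_ ∷ p) k = ≡.refl

  tl-+ : ∀ p q → tl (p +ₚ q) ≡ tl p +ₚ tl q
  tl-+ []      q       = ≡.refl
  tl-+ (_ ∷ p) (_ ∷ q) = ≡.refl
  tl-+ (_ ∷ [])    [] = ≡.refl
  tl-+ (_ ∷ _ ∷ p) [] = ≡.refl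

  tl-scale : ∀ a p → tl (scale a p) ≡ scale a (tl p)
  tl-scale a []      = ≡.refl
  tl-scale a (_ ∷ p) = ≡.refl

  tl-cong : ∀ {p q} → p ≅ q → tl p ≅ tl q
  tl-cong {p} {q} p≅q .at k = begin
    coeff (tl p) k    ≡⟨ coeff-tl p k ⟩
    coeff p (suc k)   ≈⟨ p≅q .at (suc k) ⟩
    coeff q (suc k)   ≡⟨ coeff-tl q k ⟨
    coeff (tl q) k    ∎

  coeff-+ : ∀ p q k → coeff (p +ₚ q) k ≈ coeff p k + coeff q k
  coeff-+ []      q       k       = sym (+-identityˡ _)
  coeff-+ (a ∷ p) []      k       = sym (+-identityʳ _)
  coeff-+ (a ∷ p) (b ∷ q) zero    = refl
  coeff-+ (a ∷ p) (b ∷ q) (suc k) = coeff-+ p q k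

  coeff-scale : ∀ a p k → coeff (scale a p) k ≈ a * coeff p k
  coeff-scale a []      k       = sym (zeroʳ a)
  coeff-scale a (b ∷ p) zero    = refl
  coeff-scale a (b ∷ p) (suc k) = coeff-scale a p k

  coeff-*-zero : ∀ p q → coeff (p *ₚ q) 0 ≈ coeff p 0 * coeff q 0
  coeff-*-zero []      q = sym (zeroˡ _)
  coeff-*-zero (a ∷ p) q = begin
    coeff (scale a q +ₚ (0# ∷ p *ₚ q)) 0   ≈⟨ coeff-+ (scale a q) _ 0 ⟩
    coeff (scale a q) 0 + 0#               ≈⟨ +-identityʳ _ ⟩
    coeff (scale a q) 0                    ≈⟨ coeff-scale a q 0 ⟩
    a * coeff q 0                          ∎

  -- The splitting p = p₀ + X · tl p, read at degree k + 1. It lets most of the semiring laws be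
  -- proved by induction on the degree.
  coeff-*-suc : ∀ p q k →
    coeff (p *ₚ q) (suc k) ≈ coeff p 0 * coeff q (suc k) + coeff (tl p *ₚ q) k
  coeff-*-suc []      q k = sym (trans (+-identityʳ _) (zeroˡ _))
  coeff-*-suc (a ∷ p) q k = trans (coeff-+ (scale a q) _ (suc k)) (+-congʳ (coeff-scale a q (suc k)))

  -- The same splitting applied to the second factor. Since `_*ₚ_` recurses on its first factor,
  -- this is the real content of commutativity.
  coeff-*-suc′ : ∀ p q k →
    coeff (p *ₚ q) (suc k) ≈ coeff p (suc k) * coeff q 0 + coeff (p *ₚ tl q) k
  coeff-*-suc′ p q zero = begin
    coeff (p *ₚ q) 1                                 ≈⟨ coeff-*-suc p q 0 ⟩
    coeff p 0 * coeff q 1 + coeff (tl p *ₚ q) 0      ≈⟨ +-congˡ (coeff-*-zero (tl p) q) ⟩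
    coeff p 0 * coeff q 1 + coeff (tl p) 0 * coeff q 0
      ≡⟨ ≡.cong₂ (λ x y → coeff p 0 * x + y * coeff q 0) (≡.sym (coeff-tl q 0)) (coeff-tl p 0) ⟩
    coeff p 0 * coeff (tl q) 0 + coeff p 1 * coeff q 0 ≈⟨ +-comm _ _ ⟩
    coeff p 1 * coeff q 0 + coeff p 0 * coeff (tl q) 0 ≈⟨ +-congˡ (coeff-*-zero p (tl q)) ⟨
    coeff p 1 * coeff q 0 + coeff (p *ₚ tl q) 0      ∎
  coeff-*-suc′ p q (suc k) = begin
    coeff (p *ₚ q) (suc (suc k))
      ≈⟨ coeff-*-suc p q (suc k) ⟩
    coeff p 0 * coeff q (suc (suc k)) + coeff (tl p *ₚ q) (suc k)
      ≈⟨ +-congˡ (coeff-*-suc′ (tl p) q k) ⟩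
    coeff p 0 * coeff q (suc (suc k)) + (coeff (tl p) (suc k) * coeff q 0 + coeff (tl p *ₚ tl q) k)
      ≡⟨ ≡.cong₂ (λ x y → coeff p 0 * x + (y * coeff q 0 + coeff (tl p *ₚ tl q) k))
           (≡.sym (coeff-tl q (suc k))) (coeff-tl p (suc k)) ⟩
    coeff p 0 * coeff (tl q) (suc k) + (coeff p (suc (suc k)) * coeff q 0 + coeff (tl p *ₚ tl q) k)
      ≈⟨ solve 3 (λ x y z → x :+ (y :+ z) := y :+ (x :+ z)) refl _ _ _ ⟩
    coeff p (suc (suc k)) * coeff q 0 + (coeff p 0 * coeff (tl q) (suc k) + coeff (tl p *ₚ tl q) k)
      ≈⟨ +-congˡ (coeff-*-suc p (tl q) k) ⟨
    coeff p (suc (suc k)) * coeff q 0 + coeff (p *ₚ tl q) (suc k)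
      ∎

  ≅-refl : ∀ {p} → p ≅ p
  ≅-refl .at k = refl

  ≅-sym : ∀ {p q} → p ≅ q → q ≅ p
  ≅-sym p≅q .at k = sym (p≅q .at k)

  ≅-trans : ∀ {p q r} → p ≅ q → q ≅ r → p ≅ r
  ≅-trans p≅q q≅r .at k = trans (p≅q .at k) (q≅r .at k)

  +ₚ-cong : ∀ {p p′ q q′} → p ≅ p′ → q ≅ q′ → p +ₚ q ≅ p′ +ₚ q′
  +ₚ-cong {p} {p′} {q} {q′} p≅p′ q≅q′ .at k = begin
    coeff (p +ₚ q) k         ≈⟨ coeff-+ p q k ⟩
    coeff p k + coeff q k    ≈⟨ +-cong (p≅p′ .at k) (q≅q′ .at k) ⟩
    coeff p′ k + coeff q′ k  ≈⟨ coeff-+ p′ q′ k ⟨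
    coeff (p′ +ₚ q′) k       ∎

  +ₚ-assoc : ∀ p q r → (p +ₚ q) +ₚ r ≅ p +ₚ (q +ₚ r)
  +ₚ-assoc p q r .at k = begin
    coeff ((p +ₚ q) +ₚ r) k              ≈⟨ coeff-+ (p +ₚ q) r k ⟩
    coeff (p +ₚ q) k + coeff r k         ≈⟨ +-congʳ (coeff-+ p q k) ⟩
    coeff p k + coeff q k + coeff r k    ≈⟨ +-assoc _ _ _ ⟩
    coeff p k + (coeff q k + coeff r k)  ≈⟨ +-congˡ (coeff-+ q r k) ⟨
    coeff p k + coeff (q +ₚ r) k         ≈⟨ coeff-+ p (q +ₚ r) k ⟨
    coeff (p +ₚ (q +ₚ r)) k              ∎

  +ₚ-comm : ∀ p q → p +ₚ q ≅ q +ₚ p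
  +ₚ-comm p q .at k = begin
    coeff (p +ₚ q) k       ≈⟨ coeff-+ p q k ⟩
    coeff p k + coeff q k  ≈⟨ +-comm _ _ ⟩
    coeff q k + coeff p k  ≈⟨ coeff-+ q p k ⟨
    coeff (q +ₚ p) k       ∎

  *ₚ-cong : ∀ {p p′ q q′} → p ≅ p′ → q ≅ q′ → p *ₚ q ≅ p′ *ₚ q′
  *ₚ-cong {p} {p′} {q} {q′} p≅p′ q≅q′ .at k = go k p≅p′
    where
    go : ∀ k {p p′} → p ≅ p′ → coeff (p *ₚ q) k ≈ coeff (p′ *ₚ q′) k
    go zero {p} {p′} p≅p′ = begin
      coeff (p *ₚ q) 0         ≈⟨ coeff-*-zero p q ⟩
      coeff p 0 * coeff q 0    ≈⟨ *-cong (p≅p′ .at 0) (q≅q′ .at 0) ⟩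
      coeff p′ 0 * coeff q′ 0  ≈⟨ coeff-*-zero p′ q′ ⟨
      coeff (p′ *ₚ q′) 0       ∎
    go (suc k) {p} {p′} p≅p′ = begin
      coeff (p *ₚ q) (suc k)
        ≈⟨ coeff-*-suc p q k ⟩
      coeff p 0 * coeff q (suc k) + coeff (tl p *ₚ q) k
        ≈⟨ +-cong (*-cong (p≅p′ .at 0) (q≅q′ .at (suc k))) (go k (tl-cong p≅p′)) ⟩
      coeff p′ 0 * coeff q′ (suc k) + coeff (tl p′ *ₚ q′) k
        ≈⟨ coeff-*-suc p′ q′ k ⟨
      coeff (p′ *ₚ q′) (suc k)
        ∎

  *ₚ-comm : ∀ p q → p *ₚ q ≅ q *ₚ p
  *ₚ-comm p q .at k = go k p q
    where
    go : ∀ k p q → coeff (p *ₚ q) k ≈ coeff (q *ₚ p) k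
    go zero p q = begin
      coeff (p *ₚ q) 0       ≈⟨ coeff-*-zero p q ⟩
      coeff p 0 * coeff q 0  ≈⟨ *-comm _ _ ⟩
      coeff q 0 * coeff p 0  ≈⟨ coeff-*-zero q p ⟨
      coeff (q *ₚ p) 0       ∎
    go (suc k) p q = begin
      coeff (p *ₚ q) (suc k)                             ≈⟨ coeff-*-suc p q k ⟩
      coeff p 0 * coeff q (suc k) + coeff (tl p *ₚ q) k  ≈⟨ +-cong (*-comm _ _) (go k (tl p) q) ⟩
      coeff q (suc k) * coeff p 0 + coeff (q *ₚ tl p) k  ≈⟨ coeff-*-suc′ q p k ⟨
      coeff (q *ₚ p) (suc k)                             ∎

  *ₚ-distribʳ : ∀ r p q → (p +ₚ q) *ₚ r ≅ (p *ₚ r) +ₚ (q *ₚ r)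
  *ₚ-distribʳ r p q .at k = trans (go k p q) (sym (coeff-+ (p *ₚ r) (q *ₚ r) k))
    where
    go : ∀ k p q → coeff ((p +ₚ q) *ₚ r) k ≈ coeff (p *ₚ r) k + coeff (q *ₚ r) k
    go zero p q = begin
      coeff ((p +ₚ q) *ₚ r) 0              ≈⟨ coeff-*-zero (p +ₚ q) r ⟩
      coeff (p +ₚ q) 0 * coeff r 0         ≈⟨ *-congʳ (coeff-+ p q 0) ⟩
      (coeff p 0 + coeff q 0) * coeff r 0  ≈⟨ distribʳ _ _ _ ⟩
      coeff p 0 * coeff r 0 + coeff q 0 * coeff r 0
        ≈⟨ +-cong (coeff-*-zero p r) (coeff-*-zero q r) ⟨
      coeff (p *ₚ r) 0 + coeff (q *ₚ r) 0  ∎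
    go (suc k) p q = begin
      coeff ((p +ₚ q) *ₚ r) (suc k)
        ≈⟨ coeff-*-suc (p +ₚ q) r k ⟩
      coeff (p +ₚ q) 0 * coeff r (suc k) + coeff (tl (p +ₚ q) *ₚ r) k
        ≈⟨ +-cong (*-congʳ (coeff-+ p q 0)) (reflexive (≡.cong (λ s → coeff (s *ₚ r) k) (tl-+ p q))) ⟩
      (coeff p 0 + coeff q 0) * coeff r (suc k) + coeff ((tl p +ₚ tl q) *ₚ r) k
        ≈⟨ +-congˡ (go k (tl p) (tl q)) ⟩
      (coeff p 0 + coeff q 0) * coeff r (suc k) + (coeff (tl p *ₚ r) k + coeff (tl q *ₚ r) k)
        ≈⟨ solve 5 (λ a b c x y → (a :+ b) :* c :+ (x :+ y) := (a :* c :+ x) :+ (b :* c :+ y))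
             refl _ _ _ _ _ ⟩
      (coeff p 0 * coeff r (suc k) + coeff (tl p *ₚ r) k)
        + (coeff q 0 * coeff r (suc k) + coeff (tl q *ₚ r) k)
        ≈⟨ +-cong (coeff-*-suc p r k) (coeff-*-suc q r k) ⟨
      coeff (p *ₚ r) (suc k) + coeff (q *ₚ r) (suc k)
        ∎

  scale-*ₚ : ∀ a p q → scale a p *ₚ q ≅ scale a (p *ₚ q)
  scale-*ₚ a p q .at k = trans (go k p) (sym (coeff-scale a (p *ₚ q) k))
    where
    go : ∀ k p → coeff (scale a p *ₚ q) k ≈ a * coeff (p *ₚ q) k
    go zero p = begin
      coeff (scale a p *ₚ q) 0         ≈⟨ coeff-*-zero (scale a p) q ⟩
      coeff (scale a p) 0 * coeff q 0  ≈⟨ *-congʳ (coeff-scale a p 0) ⟩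
      a * coeff p 0 * coeff q 0        ≈⟨ *-assoc _ _ _ ⟩
      a * (coeff p 0 * coeff q 0)      ≈⟨ *-congˡ (coeff-*-zero p q) ⟨
      a * coeff (p *ₚ q) 0             ∎
    go (suc k) p = begin
      coeff (scale a p *ₚ q) (suc k)
        ≈⟨ coeff-*-suc (scale a p) q k ⟩
      coeff (scale a p) 0 * coeff q (suc k) + coeff (tl (scale a p) *ₚ q) k
        ≈⟨ +-cong (*-congʳ (coeff-scale a p 0))
                  (reflexive (≡.cong (λ s → coeff (s *ₚ q) k) (tl-scale a p))) ⟩
      a * coeff p 0 * coeff q (suc k) + coeff (scale a (tl p) *ₚ q) k
        ≈⟨ +-congˡ (go k (tl p)) ⟩
      a * coeff p 0 * coeff q (suc k) + a * coeff (tl p *ₚ q) k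
        ≈⟨ solve 4 (λ a b c d → a :* b :* c :+ a :* d := a :* (b :* c :+ d)) refl _ _ _ _ ⟩
      a * (coeff p 0 * coeff q (suc k) + coeff (tl p *ₚ q) k)
        ≈⟨ *-congˡ (coeff-*-suc p q k) ⟨
      a * coeff (p *ₚ q) (suc k)
        ∎

  -- For associativity, where the left factor is itself a product whose tail has to be exposed
  -- before the induction can continue.
  tl-* : ∀ p q → tl (p *ₚ q) ≅ scale (coeff p 0) (tl q) +ₚ (tl p *ₚ q)
  tl-* p q .at k = begin
    coeff (tl (p *ₚ q)) k                                    ≡⟨ coeff-tl (p *ₚ q) k ⟩
    coeff (p *ₚ q) (suc k)                                   ≈⟨ coeff-*-suc p q k ⟩
    coeff p 0 * coeff q (suc k) + coeff (tl p *ₚ q) k        ≡⟨ ≡.cong (λ x → coeff p 0 * x + coeff (tl p *ₚ q) k) (coeff-tl q k) ⟨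
    coeff p 0 * coeff (tl q) k + coeff (tl p *ₚ q) k         ≈⟨ +-congʳ (coeff-scale _ (tl q) k) ⟨
    coeff (scale (coeff p 0) (tl q)) k + coeff (tl p *ₚ q) k ≈⟨ coeff-+ (scale _ (tl q)) _ k ⟨
    coeff (scale (coeff p 0) (tl q) +ₚ (tl p *ₚ q)) k        ∎

  *ₚ-assoc : ∀ p q r → (p *ₚ q) *ₚ r ≅ p *ₚ (q *ₚ r)
  *ₚ-assoc p q r .at k = go k p
    where
    go : ∀ k p → coeff ((p *ₚ q) *ₚ r) k ≈ coeff (p *ₚ (q *ₚ r)) k
    go zero p = begin
      coeff ((p *ₚ q) *ₚ r) 0              ≈⟨ coeff-*-zero (p *ₚ q) r ⟩
      coeff (p *ₚ q) 0 * coeff r 0         ≈⟨ *-congʳ (coeff-*-zero p q) ⟩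
      coeff p 0 * coeff q 0 * coeff r 0    ≈⟨ *-assoc _ _ _ ⟩
      coeff p 0 * (coeff q 0 * coeff r 0)  ≈⟨ *-congˡ (coeff-*-zero q r) ⟨
      coeff p 0 * coeff (q *ₚ r) 0         ≈⟨ coeff-*-zero p (q *ₚ r) ⟨
      coeff (p *ₚ (q *ₚ r)) 0              ∎
    go (suc k) p = begin
      coeff ((p *ₚ q) *ₚ r) (suc k)
        ≈⟨ coeff-*-suc (p *ₚ q) r k ⟩
      coeff (p *ₚ q) 0 * coeff r (suc k) + coeff (tl (p *ₚ q) *ₚ r) k
        ≈⟨ +-cong (*-congʳ (coeff-*-zero p q)) (*ₚ-cong (tl-* p q) (≅-refl {r}) .at k) ⟩
      p₀ * q₀ * coeff r (suc k) + coeff ((scale p₀ (tl q) +ₚ (tl p *ₚ q)) *ₚ r) k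
        ≈⟨ +-congˡ (trans (*ₚ-distribʳ r (scale p₀ (tl q)) (tl p *ₚ q) .at k)
             (coeff-+ (scale p₀ (tl q) *ₚ r) _ k)) ⟩
      p₀ * q₀ * coeff r (suc k) + (coeff (scale p₀ (tl q) *ₚ r) k + coeff ((tl p *ₚ q) *ₚ r) k)
        ≈⟨ +-congˡ (+-cong (trans (scale-*ₚ p₀ (tl q) r .at k) (coeff-scale p₀ (tl q *ₚ r) k))
             (go k (tl p))) ⟩
      p₀ * q₀ * coeff r (suc k) + (p₀ * coeff (tl q *ₚ r) k + coeff (tl p *ₚ (q *ₚ r)) k)
        ≈⟨ solve 5 (λ a b c d e → a :* b :* c :+ (a :* d :+ e) := a :* (b :* c :+ d) :+ e)
             refl _ _ _ _ _ ⟩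
      p₀ * (q₀ * coeff r (suc k) + coeff (tl q *ₚ r) k) + coeff (tl p *ₚ (q *ₚ r)) k
        ≈⟨ +-congʳ (*-congˡ (coeff-*-suc q r k)) ⟨
      p₀ * coeff (q *ₚ r) (suc k) + coeff (tl p *ₚ (q *ₚ r)) k
        ≈⟨ coeff-*-suc p (q *ₚ r) k ⟨
      coeff (p *ₚ (q *ₚ r)) (suc k)
        ∎
      where
      p₀ = coeff p 0
      q₀ = coeff q 0

  constₚ-* : ∀ a p → constₚ a *ₚ p ≅ scale a p
  constₚ-* a p .at k = trans (coeff-+ (scale a p) (0# ∷ []) k) (trans (+-congˡ (0∷[] k)) (+-identityʳ _))
    where
    0∷[] : ∀ k → coeff (0# ∷ []) k ≈ 0#
    0∷[] zero    = refl
    0∷[] (suc k) = refl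

  *ₚ-identityˡ : ∀ p → constₚ 1# *ₚ p ≅ p
  *ₚ-identityˡ p .at k =
    trans (constₚ-* 1# p .at k) (trans (coeff-scale 1# p k) (*-identityˡ _))

  -- The operations are those of `polyRawSemiring`, so that general lemmas and the solver apply to
  -- the generating function as it is defined; only powers need a translation, `^ₚ≡^`.
  polyCommutativeSemiring : CommutativeSemiring c ℓ
  polyCommutativeSemiring = record
    { Carrier = Poly
    ; _≈_     = _≅_
    ; _+_     = _+ₚ_
    ; _*_     = _*ₚ_
    ; 0#      = []
    ; 1#      = constₚ 1#
    ; isCommutativeSemiring = record
      { isSemiring = record
        { isSemiringWithoutAnnihilatingZero = record
          { +-isCommutativeMonoid = record
            { isMonoid = record
              { isSemigroup = record
                { isMagma = record
                  { isEquivalence = record { refl = ≅-refl ; sym = ≅-sym ; trans = ≅-trans }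
                  ; ∙-cong        = +ₚ-cong
                  }
                ; assoc = +ₚ-assoc
                }
              ; identity = (λ _ → ≅-refl) , (λ p → +ₚ-comm p [])
              }
            ; comm = +ₚ-comm
            }
          ; *-cong     = *ₚ-cong
          ; *-assoc    = *ₚ-assoc
          ; *-identity = *ₚ-identityˡ , (λ p → ≅-trans (*ₚ-comm p _) (*ₚ-identityˡ p))
          ; distrib    = (λ r p q → ≅-trans (*ₚ-comm r (p +ₚ q)) (≅-trans (*ₚ-distribʳ r p q)
                           (+ₚ-cong (*ₚ-comm p r) (*ₚ-comm q r))))
                       , *ₚ-distribʳ
          }
        ; zero = (λ _ → ≅-refl) , (λ p → *ₚ-comm p [])
        }
      ; *-comm = *ₚ-comm
      }
    }

-- Derivatives and composition of polynomials

module Calculus {c ℓ} (R : CommutativeRing c ℓ) where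
  open Polynomial R
  open PolynomialSemiring R
  open CommutativeSemiring polyCommutativeSemiring hiding (Carrier; zero)
  open import Algebra.Solver.Ring.NaturalCoefficients.Default polyCommutativeSemiring
  open import Algebra.Properties.Semiring.Exp semiring using (_^_)
  open import Algebra.Properties.Semiring.Sum semiring using (sum)
  open import Relation.Binary.Reasoning.Setoid setoid
  private
    module R where
      open CommutativeRing R public
      open RawSemiringDefinitions (Semiring.rawSemiring (CommutativeRing.semiring R)) public
        using (_^_) renaming (_×_ to _·_)
      open import Algebra.Properties.CommutativeMonoid.Mult (CommutativeRing.+-commutativeMonoid R) public
        using (×-congʳ; ×-distrib-+)
    open R using (Carrier)

  n·0≈0 : ∀ n → n R.· R.0# R.≈ R.0#
  n·0≈0 zero    = R.refl
  n·0≈0 (suc n) = R.trans (R.+-identityˡ _) (n·0≈0 n)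

  constₚ-cong : ∀ {a b} → a R.≈ b → constₚ a ≈ constₚ b
  constₚ-cong a≈b .at zero    = a≈b
  constₚ-cong a≈b .at (suc k) = R.refl

  constₚ-0 : constₚ R.0# ≈ 0#
  constₚ-0 .at zero    = R.refl
  constₚ-0 .at (suc k) = R.refl

  constₚ-homo-* : ∀ a b → constₚ (a R.* b) ≈ constₚ a * constₚ b
  constₚ-homo-* a b = sym (constₚ-* a (constₚ b))

  constₚ-homo-^ : ∀ a n → constₚ (a R.^ n) ≈ constₚ a ^ n
  constₚ-homo-^ a zero    = refl
  constₚ-homo-^ a (suc n) = trans (constₚ-homo-* a (a R.^ n)) (*-congˡ {constₚ a} (constₚ-homo-^ a n))

  X-* : ∀ p → X * p ≈ R.0# ∷ p
  X-* p .at zero    = R.trans (coeff-*-zero X p) (R.zeroˡ _)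
  X-* p .at (suc k) = R.trans (coeff-*-suc X p k)
    (R.trans (R.+-cong (R.zeroˡ _) (*-identityˡ p .at k)) (R.+-identityˡ _))

  -- Turns the list induction of `derivative-*` into algebra that the solver can finish.
  ∷-≈ : ∀ a p → a ∷ p ≈ constₚ a + X * p
  ∷-≈ a p = trans (lemma a p) (+-congˡ {constₚ a} (sym (X-* p)))
    where
    lemma : ∀ a p → a ∷ p ≈ constₚ a + (R.0# ∷ p)
    lemma a p .at zero    = R.sym (R.+-identityʳ a)
    lemma a p .at (suc k) = R.refl

  coeff-derivative : ∀ p k → coeff (derivative p) k R.≈ suc k R.· coeff p (suc k)
  coeff-derivative []      k = R.sym (n·0≈0 (suc k))
  coeff-derivative (_ ∷ p) k = go suc p k
    where
    -- `applyUpTo` composes its function with `suc` at each step, so the claim is generalised from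
    -- `suc` to any `f`.
    go : ∀ f p k → coeff (List.zipWith R._·_ (List.applyUpTo f (List.length p)) p) k R.≈ f k R.· coeff p k
    go f []      k       = R.sym (n·0≈0 (f k))
    go f (a ∷ p) zero    = R.refl
    go f (a ∷ p) (suc k) = go (λ n → f (suc n)) p k

  derivative-cong : ∀ {p q} → p ≈ q → derivative p ≈ derivative q
  derivative-cong {p} {q} p≈q .at k = R.trans (coeff-derivative p k)
    (R.trans (R.×-congʳ (suc k) (p≈q .at (suc k))) (R.sym (coeff-derivative q k)))

  derivative-+ : ∀ p q → derivative (p + q) ≈ derivative p + derivative q
  derivative-+ p q .at k =
    R.trans (coeff-derivative (p + q) k)
    (R.trans (R.×-congʳ (suc k) (coeff-+ p q (suc k)))
    (R.trans (R.×-distrib-+ _ _ (suc k))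
    (R.trans (R.+-cong (R.sym (coeff-derivative p k)) (R.sym (coeff-derivative q k)))
             (R.sym (coeff-+ (derivative p) _ k)))))

  -- The definition of `derivative` zips with 1, 2, 3, ... and does not recurse on itself; Leibniz's
  -- rule for a + X p supplies the recursion.
  derivative-∷ : ∀ a p → derivative (a ∷ p) ≈ p + X * derivative p
  derivative-∷ a p = trans (lemma a p) (+-congˡ (sym (X-* (derivative p))))
    where
    lemma : ∀ a p → derivative (a ∷ p) ≈ p + (R.0# ∷ derivative p)
    lemma a p .at zero    = R.trans (coeff-derivative (a ∷ p) 0)
      (R.sym (coeff-+ p (R.0# ∷ derivative p) 0))
    lemma a p .at (suc k) = R.trans (coeff-derivative (a ∷ p) (suc k))
      (R.trans (R.+-congˡ (R.sym (coeff-derivative p k)))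
        (R.sym (coeff-+ p (R.0# ∷ derivative p) (suc k))))

  derivative-X* : ∀ p → derivative (X * p) ≈ p + X * derivative p
  derivative-X* p = trans (derivative-cong (X-* p)) (derivative-∷ R.0# p)

  derivative-const* : ∀ a p → derivative (constₚ a * p) ≈ constₚ a * derivative p
  derivative-const* a []      = sym (zeroʳ (constₚ a))
  derivative-const* a (b ∷ p) = begin
    derivative (constₚ a * (b ∷ p))                  ≈⟨ derivative-cong (constₚ-* a (b ∷ p)) ⟩
    derivative (scale a (b ∷ p))                     ≈⟨ derivative-∷ (a R.* b) (scale a p) ⟩
    scale a p + X * derivative (scale a p)
      ≈⟨ +-cong (constₚ-* a p) (*-congˡ {X} (derivative-cong (constₚ-* a p))) ⟨
    constₚ a * p + X * derivative (constₚ a * p)     ≈⟨ +-congˡ {constₚ a * p} (*-congˡ {X} (derivative-const* a p)) ⟩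
    constₚ a * p + X * (constₚ a * derivative p)
      ≈⟨ solve 4 (λ a p x q → a :* p :+ x :* (a :* q) := a :* (p :+ x :* q)) refl (constₚ a) p X (derivative p) ⟩
    constₚ a * (p + X * derivative p)                ≈⟨ *-congˡ {constₚ a} (derivative-∷ b p) ⟨
    constₚ a * derivative (b ∷ p)                    ∎

  derivative-* : ∀ p q → derivative (p * q) ≈ derivative p * q + p * derivative q
  derivative-* []      q = refl
  derivative-* (a ∷ p) q = begin
    derivative ((a ∷ p) * q)
      ≈⟨ derivative-cong (*-congʳ (∷-≈ a p)) ⟩
    derivative ((A + X * p) * q)
      ≈⟨ derivative-cong (solve 4 (λ a x p q → (a :+ x :* p) :* q := a :* q :+ x :* (p :* q)) refl A X p q) ⟩
    derivative (A * q + X * (p * q))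
      ≈⟨ derivative-+ (A * q) _ ⟩
    derivative (A * q) + derivative (X * (p * q))
      ≈⟨ +-cong (derivative-const* a q) (derivative-X* (p * q)) ⟩
    A * q′ + (p * q + X * derivative (p * q))
      ≈⟨ +-congˡ {A * q′} (+-congˡ {p * q} (*-congˡ {X} (derivative-* p q))) ⟩
    A * q′ + (p * q + X * (p′ * q + p * q′))
      ≈⟨ solve 6 (λ a x p q p′ q′ → a :* q′ :+ (p :* q :+ x :* (p′ :* q :+ p :* q′)) :=
                   (p :+ x :* p′) :* q :+ (a :+ x :* p) :* q′) refl A X p q p′ q′ ⟩
    (p + X * p′) * q + (A + X * p) * q′
      ≈⟨ +-cong (*-congʳ (derivative-∷ a p)) (*-congʳ (∷-≈ a p)) ⟨
    derivative (a ∷ p) * q + (a ∷ p) * q′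
      ∎
    where
    A = constₚ a
    p′ = derivative p
    q′ = derivative q

  derivative-sum : ∀ {n} (f : Fin n → Poly) → derivative (sum f) ≈ sum (λ i → derivative (f i))
  derivative-sum {zero}  f = refl
  derivative-sum {suc n} f = trans (derivative-+ (f zero) _) (+-congˡ (derivative-sum (λ i → f (suc i))))

  infixr 9 _∘ₚ_

  _∘ₚ_ : Poly → Poly → Poly
  []      ∘ₚ t = []
  (a ∷ p) ∘ₚ t = constₚ a + t * (p ∘ₚ t)

  -- Once one list has run out, the remaining coefficients of the other equal 0, and Horner's scheme
  -- for them collapses to 0 + t · 0.
  ∘ₚ-cong : ∀ {p q} t → p ≈ q → p ∘ₚ t ≈ q ∘ₚ t
  ∘ₚ-cong {[]}    {[]}    t p≈q = refl
  ∘ₚ-cong {[]}    {b ∷ q} t p≈q = sym (trans (+-cong (trans (constₚ-cong (R.sym (p≈q .at 0))) constₚ-0)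
    (*-congˡ {t} (sym (∘ₚ-cong {[]} {q} t (tl-cong p≈q))))) (zeroʳ t))
  ∘ₚ-cong {a ∷ p} {[]}    t p≈q = trans (+-cong (trans (constₚ-cong (p≈q .at 0)) constₚ-0)
    (*-congˡ {t} (∘ₚ-cong {p} {[]} t (tl-cong p≈q)))) (zeroʳ t)
  ∘ₚ-cong {a ∷ p} {b ∷ q} t p≈q = +-cong (constₚ-cong (p≈q .at 0)) (*-congˡ {t} (∘ₚ-cong {p} {q} t (tl-cong p≈q)))

  ∘ₚ-+ : ∀ p q t → (p + q) ∘ₚ t ≈ p ∘ₚ t + q ∘ₚ t
  ∘ₚ-+ []      q       t = refl
  ∘ₚ-+ (a ∷ p) []      t = sym (+-identityʳ _)
  ∘ₚ-+ (a ∷ p) (b ∷ q) t = trans (+-congˡ {constₚ a + constₚ b} (*-congˡ {t} (∘ₚ-+ p q t)))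
    (solve 5 (λ a b t p q → (a :+ b) :+ t :* (p :+ q) := (a :+ t :* p) :+ (b :+ t :* q)) refl
      (constₚ a) (constₚ b) t (p ∘ₚ t) (q ∘ₚ t))

  ∘ₚ-scale : ∀ a p t → scale a p ∘ₚ t ≈ constₚ a * (p ∘ₚ t)
  ∘ₚ-scale a []      t = sym (zeroʳ (constₚ a))
  ∘ₚ-scale a (b ∷ p) t = trans (+-cong (constₚ-homo-* a b) (*-congˡ {t} (∘ₚ-scale a p t)))
    (solve 4 (λ a b t p → a :* b :+ t :* (a :* p) := a :* (b :+ t :* p)) refl
      (constₚ a) (constₚ b) t (p ∘ₚ t))

  ∘ₚ-* : ∀ p q t → (p * q) ∘ₚ t ≈ (p ∘ₚ t) * (q ∘ₚ t)
  ∘ₚ-* []      q t = refl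
  ∘ₚ-* (a ∷ p) q t = begin
    (scale a q + (R.0# ∷ p * q)) ∘ₚ t
      ≈⟨ ∘ₚ-+ (scale a q) _ t ⟩
    scale a q ∘ₚ t + (constₚ R.0# + t * ((p * q) ∘ₚ t))
      ≈⟨ +-cong (∘ₚ-scale a q t) (+-cong constₚ-0 (*-congˡ {t} (∘ₚ-* p q t))) ⟩
    constₚ a * (q ∘ₚ t) + t * ((p ∘ₚ t) * (q ∘ₚ t))
      ≈⟨ solve 4 (λ a q t p → a :* q :+ t :* (p :* q) := (a :+ t :* p) :* q) refl
           (constₚ a) (q ∘ₚ t) t (p ∘ₚ t) ⟩
    (constₚ a + t * (p ∘ₚ t)) * (q ∘ₚ t)
      ∎

  constₚ-∘ₚ : ∀ a t → constₚ a ∘ₚ t ≈ constₚ a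
  constₚ-∘ₚ a t = trans (+-congˡ (zeroʳ t)) (+-identityʳ _)

  X-∘ₚ : ∀ t → X ∘ₚ t ≈ t
  X-∘ₚ t = begin
    constₚ R.0# + t * (constₚ R.1# ∘ₚ t)  ≈⟨ +-cong constₚ-0 (*-congˡ {t} (constₚ-∘ₚ R.1# t)) ⟩
    t * 1#                                ≈⟨ *-identityʳ t ⟩
    t                                     ∎

  ∘ₚ-sum : ∀ {n} (f : Fin n → Poly) t → sum f ∘ₚ t ≈ sum (λ i → f i ∘ₚ t)
  ∘ₚ-sum {zero}  f t = refl
  ∘ₚ-sum {suc n} f t = trans (∘ₚ-+ (f zero) _ t) (+-congˡ (∘ₚ-sum (λ i → f (suc i)) t))

  ∘ₚ-^ : ∀ p n t → (p ^ n) ∘ₚ t ≈ (p ∘ₚ t) ^ n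
  ∘ₚ-^ p zero    t = constₚ-∘ₚ R.1# t
  ∘ₚ-^ p (suc n) t = trans (∘ₚ-* p (p ^ n) t) (*-congˡ {p ∘ₚ t} (∘ₚ-^ p n t))

  -- Holds by computation, because `0#` is the empty list and a product with `[]` on the left
  -- reduces to `[]`.
  coeff-∘ₚ-0 : ∀ p → coeff (p ∘ₚ 0#) 0 R.≈ coeff p 0
  coeff-∘ₚ-0 []      = R.refl
  coeff-∘ₚ-0 (a ∷ p) = R.refl

-- Sources of digraphs, and the addition of a source

isSource : ∀ {n} → Digraph n → Fin n → Bool
isSource G j = does (inDegree G j ℕ.≟ 0)

∣insertAt∣ : ∀ {n} (p : Subset n) i b → ∣ insertAt p i b ∣ ≡ ∣ b Vec.∷ p ∣
∣insertAt∣ p                 zero    b       = ≡.refl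
∣insertAt∣ (inside  Vec.∷ p) (suc i) inside  = cong suc (∣insertAt∣ p i inside)
∣insertAt∣ (inside  Vec.∷ p) (suc i) outside = cong suc (∣insertAt∣ p i outside)
∣insertAt∣ (outside Vec.∷ p) (suc i) b       = ∣insertAt∣ p i b

∣p∣≡0⇒outside : ∀ {n} (p : Subset n) → ∣ p ∣ ≡ 0 → ∀ i → lookup p i ≡ outside
∣p∣≡0⇒outside (outside Vec.∷ p) eq zero    = ≡.refl
∣p∣≡0⇒outside (outside Vec.∷ p) eq (suc i) = ∣p∣≡0⇒outside p eq i

∣p∣≢0⇒inside : ∀ {n} (p : Subset n) → ∣ p ∣ ≢ 0 → ∃ λ i → lookup p i ≡ inside
∣p∣≢0⇒inside Vec.[]            ≢0 = contradiction ≡.refl ≢0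
∣p∣≢0⇒inside (inside  Vec.∷ p) ≢0 = zero , ≡.refl
∣p∣≢0⇒inside (outside Vec.∷ p) ≢0 = let i , eq = ∣p∣≢0⇒inside p ≢0 in suc i , eq

sum-insertAt : ∀ {n} (xs : Vec ℕ n) i x → Vec.sum (insertAt xs i x) ≡ x ℕ.+ Vec.sum xs
sum-insertAt xs             zero    x = ≡.refl
sum-insertAt (y Vec.∷ xs) (suc i) x = begin
  y ℕ.+ Vec.sum (insertAt xs i x)  ≡⟨ cong (y ℕ.+_) (sum-insertAt xs i x) ⟩
  y ℕ.+ (x ℕ.+ Vec.sum xs)         ≡⟨ ℕ.+-assoc y x _ ⟨
  y ℕ.+ x ℕ.+ Vec.sum xs           ≡⟨ cong (ℕ._+ Vec.sum xs) (ℕ.+-comm y x) ⟩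
  x ℕ.+ y ℕ.+ Vec.sum xs           ≡⟨ ℕ.+-assoc x y _ ⟩
  x ℕ.+ (y ℕ.+ Vec.sum xs)         ∎
  where open ≡.≡-Reasoning

lookup-inNeighbours : ∀ {n} (G : Digraph n) i j →
                      lookup (inNeighbours G j) i ≡ lookup (lookup G i) j
lookup-inNeighbours G i j = lookup-map i (λ row → lookup row j) G

edge-into⇒¬isSource : ∀ {n} (G : Digraph n) i {j} →
                      lookup (lookup G i) j ≡ inside → isSource G j ≡ false
edge-into⇒¬isSource G i {j} i→j = dec-false (inDegree G j ℕ.≟ 0) λ eq → contradiction
  (≡.trans (≡.sym i→j) (≡.trans (≡.sym (lookup-inNeighbours G i j)) (∣p∣≡0⇒outside (inNeighbours G j) eq i)))
  λ ()

-- Without sources, following edges backwards from any vertex eventually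
-- repeats a vertex.
acyclic⇒source : ∀ {n} (G : Digraph (suc n)) → Acyclic G → ∃ λ j → inDegree G j ≡ 0
acyclic⇒source {n} G acyclic with Fin.any? (λ j → inDegree G j ℕ.≟ 0)
... | yes source = source
... | no ¬source = contradiction cycle (acyclic (back (toℕ a)))
  where
  inEdge : ∀ j → ∃ λ i → Edge G i j
  inEdge j =
    let i , eq = ∣p∣≢0⇒inside (inNeighbours G j) (λ eq → ¬source (j , eq))
    in i , lookup⇒[]= j _ (≡.trans (≡.sym (lookup-inNeighbours G i j)) eq)

  back : ℕ → Fin (suc n)
  back zero    = zero
  back (suc k) = proj₁ (inEdge (back k))

  -- `back` walks against the edges, so paths lead from later indices to earlier ones.
  path : ∀ k d → TransClosure (Edge G) (back (suc d ℕ.+ k)) (back k)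
  path k zero    = [ proj₂ (inEdge (back k)) ]
  path k (suc d) = proj₂ (inEdge (back (suc d ℕ.+ k))) ∷ path k d

  repetition : ∃ λ a → ∃ λ b → a Fin.< b × back (toℕ a) ≡ back (toℕ b)
  repetition = Fin.pigeonhole (ℕ.n<1+n (suc n)) (back ∘ toℕ)

  a b : Fin (suc (suc n))
  a = proj₁ repetition
  b = proj₁ (proj₂ repetition)

  gap : ∃ λ d → suc d ℕ.+ toℕ a ≡ toℕ b
  gap = let d , eq = ℕ.m≤n⇒∃[o]m+o≡n (proj₁ (proj₂ (proj₂ repetition)))
        in d , ≡.trans (cong suc (ℕ.+-comm d (toℕ a))) eq

  cycle : TransClosure (Edge G) (back (toℕ a)) (back (toℕ a))
  cycle = subst (λ v → TransClosure (Edge G) v (back (toℕ a)))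
    (≡.trans (cong back (proj₂ gap)) (≡.sym (proj₂ (proj₂ (proj₂ repetition)))))
    (path (toℕ a) (proj₁ gap))

-- Every digraph with i as a source is addSource i r G for unique r (the
-- out-neighbours of i) and G (the rest of the digraph).

isolate : ∀ {n m} → Fin (suc n) → Vec (Subset n) m → Vec (Subset (suc n)) m
isolate i = Vec.map (λ row → insertAt row i outside)

addSource : ∀ {n} → Fin (suc n) → Subset n → Digraph n → Digraph (suc n)
addSource i r G = insertAt (isolate i G) i (insertAt r i outside)

module _ {n} (i : Fin (suc n)) (r : Subset n) (G : Digraph n) where
  private
    G⁺ : Digraph (suc n)
    G⁺ = addSource i r G

  row-old : ∀ j → lookup G⁺ (punchIn i j) ≡ insertAt (lookup G j) i outside
  row-old j = ≡.trans (insertAt-punchIn (isolate i G) i _ j) (lookup-map j _ G)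

  lookup-old : ∀ j k → lookup (lookup G⁺ (punchIn i j)) (punchIn i k) ≡ lookup (lookup G j) k
  lookup-old j k = ≡.trans (cong (λ row → lookup row (punchIn i k)) (row-old j))
    (insertAt-punchIn (lookup G j) i outside k)

  inNeighbours-addSource : ∀ k →
    inNeighbours G⁺ k ≡
    insertAt (Vec.map (λ row → lookup (insertAt row i outside) k) G) i (lookup (insertAt r i outside) k)
  inNeighbours-addSource k = ≡.trans
    (map-insertAt (λ row → lookup row k) (insertAt r i outside) (isolate i G) i)
    (cong (λ v → insertAt v i _) (≡.sym (map-∘ (λ row → lookup row k) (λ row → insertAt row i outside) G)))

  inNeighbours-new : inNeighbours G⁺ i ≡ insertAt (Vec.replicate n outside) i outside
  inNeighbours-new = begin
    inNeighbours G⁺ i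
      ≡⟨ inNeighbours-addSource i ⟩
    insertAt (Vec.map (λ row → lookup (insertAt row i outside) i) G) i (lookup (insertAt r i outside) i)
      ≡⟨ cong₂ (λ v b → insertAt v i b) (map-cong (λ row → insertAt-lookup row i outside) G)
           (insertAt-lookup r i outside) ⟩
    insertAt (Vec.map (λ _ → outside) G) i outside
      ≡⟨ cong (λ v → insertAt v i outside) (map-const G outside) ⟩
    insertAt (Vec.replicate n outside) i outside
      ∎
    where open ≡.≡-Reasoning

  inNeighbours-old : ∀ k → inNeighbours G⁺ (punchIn i k) ≡ insertAt (inNeighbours G k) i (lookup r k)
  inNeighbours-old k = ≡.trans (inNeighbours-addSource (punchIn i k))
    (cong₂ (λ v b → insertAt v i b) (map-cong (λ row → insertAt-punchIn row i outside k) G)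
      (insertAt-punchIn r i outside k))

  isSource-new : isSource G⁺ i ≡ true
  isSource-new = dec-true (inDegree G⁺ i ℕ.≟ 0)
    (≡.trans (cong ∣_∣ inNeighbours-new)
      (≡.trans (∣insertAt∣ (Vec.replicate n outside) i outside) (∣⊥∣≡0 n)))

  -- The only in-neighbour that an old vertex can gain is `i`, and it does so exactly when it lies
  -- in `r`.
  isSource-old : ∀ k → isSource G⁺ (punchIn i k) ≡ isSource G k ∧ not (lookup r k)
  isSource-old k = ≡.trans
    (cong (λ d → does (d ℕ.≟ 0)) (≡.trans (cong ∣_∣ (inNeighbours-old k)) (∣insertAt∣ _ i _)))
    (lemma (lookup r k))
    where
    lemma : ∀ b → does (∣ b Vec.∷ inNeighbours G k ∣ ℕ.≟ 0) ≡ isSource G k ∧ not b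
    lemma inside  with isSource G k
    ... | true  = ≡.refl
    ... | false = ≡.refl
    lemma outside with isSource G k
    ... | true  = ≡.refl
    ... | false = ≡.refl

  edges-addSource : edges G⁺ ≡ ∣ r ∣ ℕ.+ edges G
  edges-addSource = begin
    Vec.sum (Vec.map ∣_∣ G⁺)
      ≡⟨ cong Vec.sum (map-insertAt ∣_∣ _ (isolate i G) i) ⟩
    Vec.sum (insertAt (Vec.map ∣_∣ (isolate i G)) i ∣ insertAt r i outside ∣)
      ≡⟨ sum-insertAt _ i _ ⟩
    ∣ insertAt r i outside ∣ ℕ.+ Vec.sum (Vec.map ∣_∣ (isolate i G))
      ≡⟨ cong₂ (λ a v → a ℕ.+ Vec.sum v) (∣insertAt∣ r i outside)
           (≡.trans (≡.sym (map-∘ ∣_∣ _ G)) (map-cong (λ row → ∣insertAt∣ row i outside) G)) ⟩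
    ∣ r ∣ ℕ.+ edges G
      ∎
    where open ≡.≡-Reasoning

  private
    edge⁺ : ∀ {j k} → Edge G j k → Edge G⁺ (punchIn i j) (punchIn i k)
    edge⁺ {j} {k} e = lookup⇒[]= _ _ (≡.trans (lookup-old j k) ([]=⇒lookup e))

    path⁺ : ∀ {j k} → TransClosure (Edge G) j k → TransClosure (Edge G⁺) (punchIn i j) (punchIn i k)
    path⁺ [ e ]   = [ edge⁺ e ]
    path⁺ (e ∷ p) = edge⁺ e ∷ path⁺ p

    -- The row of an old vertex is empty at position `i`, so its edges lead to old vertices.
    edge⁻ : ∀ {j v} → Edge G⁺ (punchIn i j) v → ∃ λ k → v ≡ punchIn i k × Edge G j k
    edge⁻ {j} {v} e with i Fin.≟ v
    ... | yes ≡.refl = contradiction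
      (≡.trans (≡.sym ([]=⇒lookup e))
        (≡.trans (cong (λ row → lookup row i) (row-old j)) (insertAt-lookup (lookup G j) i outside)))
      λ ()
    ... | no i≢v = k , v≡k , lookup⇒[]= k _
        (≡.trans (≡.sym (lookup-old j k)) ([]=⇒lookup (subst (Edge G⁺ (punchIn i j)) v≡k e)))
      where
      k = punchOut i≢v
      v≡k = ≡.sym (Fin.punchIn-punchOut i≢v)

    path⁻ : ∀ {j v} → TransClosure (Edge G⁺) (punchIn i j) v → ∃ λ k → v ≡ punchIn i k × TransClosure (Edge G) j k
    path⁻ [ e ] with edge⁻ e
    ... | k , eq , e′ = k , eq , [ e′ ]
    path⁻ (e ∷ p) with edge⁻ e
    ... | k , ≡.refl , e′ with path⁻ p
    ...   | l , eq , p′ = l , eq , e′ ∷ p′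

    noEdgeInto-i : ∀ v → ¬ Edge G⁺ v i
    noEdgeInto-i v e = contradiction
      (≡.trans (≡.sym (edge-into⇒¬isSource G⁺ v ([]=⇒lookup e))) isSource-new) λ ()

    noPathInto-i : ∀ {v} → ¬ TransClosure (Edge G⁺) v i
    noPathInto-i [ e ]   = noEdgeInto-i _ e
    noPathInto-i (e ∷ p) = noPathInto-i p

  -- No edge enters `i`, so no cycle passes through it; any other cycle stays among the old
  -- vertices, where `punchIn i` identifies the two edge relations.
  acyclic-addSource : Acyclic G⁺ ⇔ Acyclic G
  acyclic-addSource = mk⇔ (λ acyclic j c → acyclic (punchIn i j) (path⁺ c)) acyclic⁺
    where
    acyclic⁺ : Acyclic G → Acyclic G⁺
    acyclic⁺ acyclic v c with i Fin.≟ v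
    ... | yes ≡.refl = noPathInto-i c
    ... | no i≢v with path⁻ (subst₂ (TransClosure (Edge G⁺)) v≡ v≡ c)
      where v≡ = ≡.sym (Fin.punchIn-punchOut i≢v)
    ...   | k , eq , c′ = acyclic k (subst (λ j → TransClosure (Edge G) j k)
                            (Fin.punchIn-injective i _ _ eq) c′)

  acyclic?-addSource : does (acyclic? G⁺) ≡ does (acyclic? G)
  acyclic?-addSource = does-⇔ acyclic-addSource (acyclic? G⁺) (acyclic? G)

-- Sums over digraphs and the recursion for marked sources

sides : List Bool
sides = outside ∷ inside ∷ []

subsets : ∀ n → List (Subset n)
subsets = vectors sides

module SourceMarking {c ℓ} (S : CommutativeSemiring c ℓ) where
  open CommutativeSemiring S hiding (zero)
  open import Algebra.Solver.Ring.NaturalCoefficients.Default S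
  open import Algebra.Properties.Semiring.Exp semiring
  open import Algebra.Properties.Semiring.Sum semiring
  open import Algebra.Properties.Semiring.Mult semiring using () renaming (_×_ to _·_)
  open import Relation.Binary.Reasoning.Setoid setoid
  private
    module Π where
      open import Algebra.Properties.CommutativeMonoid.Sum *-commutativeMonoid public

  private
    variable
      a b p : Level
      A : Set a
      B : Set b

  -- Has the shape of the sum in `DAG`, so that over polynomials the two agree by computation.
  sumOver : ∀ {a} {A : Set a} → List A → (A → Carrier) → Carrier
  sumOver xs f = List.foldr _+_ 0# (List.map f xs)

  product : ∀ {n} → (Fin n → Carrier) → Carrier
  product = Π.sum

  sumOver-cong : ∀ (xs : List A) {f g} → (∀ x → f x ≈ g x) → sumOver xs f ≈ sumOver xs g
  sumOver-cong []       f≈g = refl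
  sumOver-cong (x ∷ xs) f≈g = +-cong (f≈g x) (sumOver-cong xs f≈g)

  sumOver-zero : ∀ (xs : List A) {f} → (∀ x → f x ≈ 0#) → sumOver xs f ≈ 0#
  sumOver-zero []       f≈0 = refl
  sumOver-zero (x ∷ xs) f≈0 = trans (+-cong (f≈0 x) (sumOver-zero xs f≈0)) (+-identityˡ 0#)

  sumOver-++ : ∀ (xs ys : List A) f → sumOver (xs ++ ys) f ≈ sumOver xs f + sumOver ys f
  sumOver-++ []       ys f = sym (+-identityˡ _)
  sumOver-++ (x ∷ xs) ys f = trans (+-congˡ (sumOver-++ xs ys f)) (sym (+-assoc _ _ _))

  sumOver-+ : ∀ (xs : List A) f g → sumOver xs (λ x → f x + g x) ≈ sumOver xs f + sumOver xs g
  sumOver-+ []       f g = sym (+-identityˡ 0#)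
  sumOver-+ (x ∷ xs) f g = trans (+-congˡ (sumOver-+ xs f g))
    (solve 4 (λ a b c d → (a :+ b) :+ (c :+ d) := (a :+ c) :+ (b :+ d)) refl _ _ _ _)

  sumOver-*ˡ : ∀ y (xs : List A) f → y * sumOver xs f ≈ sumOver xs (λ x → y * f x)
  sumOver-*ˡ y []       f = zeroʳ y
  sumOver-*ˡ y (x ∷ xs) f = trans (distribˡ y _ _) (+-congˡ (sumOver-*ˡ y xs f))

  sumOver-map : ∀ (h : B → A) ys f → sumOver (List.map h ys) f ≈ sumOver ys (f ∘ h)
  sumOver-map h []       f = refl
  sumOver-map h (y ∷ ys) f = +-congˡ (sumOver-map h ys f)

  sumOver-filter : ∀ {P : A → Set p} (P? : Decidable P) xs f →
    sumOver (filter P? xs) f ≈ sumOver xs (λ x → if does (P? x) then f x else 0#)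
  sumOver-filter P? []       f = refl
  sumOver-filter P? (x ∷ xs) f with does (P? x)
  ... | true  = +-congˡ (sumOver-filter P? xs f)
  ... | false = trans (sumOver-filter P? xs f) (sym (+-identityˡ _))

  sumOver-swap : ∀ (xs : List A) (ys : List B) (f : A → B → Carrier) →
    sumOver xs (λ x → sumOver ys (f x)) ≈ sumOver ys (λ y → sumOver xs (λ x → f x y))
  sumOver-swap []       ys f = sym (sumOver-zero ys (λ _ → refl))
  sumOver-swap (x ∷ xs) ys f = trans (+-congˡ (sumOver-swap xs ys f))
    (sym (sumOver-+ ys (f x) (λ y → sumOver xs (λ x → f x y))))

  sumOver-sum : ∀ {n} (xs : List A) (f : A → Fin n → Carrier) →
    sumOver xs (λ x → sum (f x)) ≈ sum (λ i → sumOver xs (λ x → f x i))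
  sumOver-sum {n = n} []  f = sym (sum-replicate-zero n)
  sumOver-sum     (x ∷ xs) f = trans (+-congˡ (sumOver-sum xs f))
    (sym (∑-distrib-+ (f x) (λ i → sumOver xs (λ x → f x i))))

  sumOver-vectors-suc : ∀ (xs : List A) n f →
    sumOver (vectors xs (suc n)) f ≈
    sumOver xs (λ x → sumOver (vectors xs n) (λ v → f (x Vec.∷ v)))
  sumOver-vectors-suc xs n f = go xs
    where
    vs = vectors xs n
    go : ∀ ys → sumOver (cartesianProductWith Vec._∷_ ys vs) f ≈
                sumOver ys (λ x → sumOver vs (λ v → f (x Vec.∷ v)))
    go []       = refl
    go (y ∷ ys) = trans (sumOver-++ (List.map (y Vec.∷_) vs) _ f)
      (+-cong (sumOver-map (y Vec.∷_) vs f) (go ys))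

  -- `vectors` enumerates the leading coordinate outermost; exchanging two finite sums brings any
  -- other coordinate to the front.
  sumOver-vectors-insertAt : ∀ (xs : List A) n i f →
    sumOver (vectors xs (suc n)) f ≈
    sumOver xs (λ x → sumOver (vectors xs n) (λ v → f (insertAt v i x)))
  sumOver-vectors-insertAt xs n       zero    f = sumOver-vectors-suc xs n f
  sumOver-vectors-insertAt xs (suc n) (suc i) f = begin
    sumOver (vectors xs (suc (suc n))) f
      ≈⟨ sumOver-vectors-suc xs (suc n) f ⟩
    sumOver xs (λ x → sumOver (vectors xs (suc n)) (λ v → f (x Vec.∷ v)))
      ≈⟨ sumOver-cong xs (λ x → sumOver-vectors-insertAt xs n i (f ∘ (x Vec.∷_))) ⟩
    sumOver xs (λ x → sumOver xs (λ y → sumOver (vectors xs n) (λ v → f (x Vec.∷ insertAt v i y))))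
      ≈⟨ sumOver-swap xs xs _ ⟩
    sumOver xs (λ y → sumOver xs (λ x → sumOver (vectors xs n) (λ v → f (x Vec.∷ insertAt v i y))))
      ≈⟨ sumOver-cong xs (λ y → sumOver-vectors-suc xs n (λ v → f (insertAt v (suc i) y))) ⟨
    sumOver xs (λ y → sumOver (vectors xs (suc n)) (λ v → f (insertAt v (suc i) y)))
      ∎

  sumOver-subsets-insertAt : ∀ n i (f : Subset (suc n) → Carrier) →
    (∀ p → lookup p i ≡ inside → f p ≈ 0#) →
    sumOver (subsets (suc n)) f ≈ sumOver (subsets n) (λ p → f (insertAt p i outside))
  sumOver-subsets-insertAt n i f f≈0 = begin
    sumOver (subsets (suc n)) f
      ≈⟨ sumOver-vectors-insertAt sides n i f ⟩
    sumOver (subsets n) (λ p → f (insertAt p i outside)) +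
      (sumOver (subsets n) (λ p → f (insertAt p i inside)) + 0#)
      ≈⟨ +-congˡ (trans (+-identityʳ _)
           (sumOver-zero (subsets n) (λ p → f≈0 _ (insertAt-lookup p i inside)))) ⟩
    sumOver (subsets n) (λ p → f (insertAt p i outside)) + 0#
      ≈⟨ +-identityʳ _ ⟩
    sumOver (subsets n) (λ p → f (insertAt p i outside))
      ∎

  -- Clears column `i` one row at a time. The number `m` of rows is separate from `n` because the
  -- induction is on the rows alone.
  sumOver-isolate : ∀ n m i (f : Vec (Subset (suc n)) m → Carrier) →
    (∀ rows j → lookup (lookup rows j) i ≡ inside → f rows ≈ 0#) →
    sumOver (vectors (subsets (suc n)) m) f ≈
    sumOver (vectors (subsets n) m) (λ rows → f (isolate i rows))
  sumOver-isolate n zero    i f f≈0 = refl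
  sumOver-isolate n (suc m) i f f≈0 = begin
    sumOver (vectors (subsets (suc n)) (suc m)) f
      ≈⟨ sumOver-vectors-suc (subsets (suc n)) m f ⟩
    sumOver (subsets (suc n)) (λ p → sumOver (vectors (subsets (suc n)) m) (λ rows → f (p Vec.∷ rows)))
      ≈⟨ sumOver-subsets-insertAt n i _ (λ p p∋i → sumOver-zero (vectors (subsets (suc n)) m) (λ rows → f≈0 (p Vec.∷ rows) zero p∋i)) ⟩
    sumOver (subsets n) (λ p → sumOver (vectors (subsets (suc n)) m) (λ rows → f (insertAt p i outside Vec.∷ rows)))
      ≈⟨ sumOver-cong (subsets n) (λ p → sumOver-isolate n m i _ (λ rows j → f≈0 _ (suc j))) ⟩
    sumOver (subsets n) (λ p → sumOver (vectors (subsets n) m) (λ rows → f (isolate i (p Vec.∷ rows))))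
      ≈⟨ sumOver-vectors-suc (subsets n) m (f ∘ isolate i) ⟨
    sumOver (vectors (subsets n) (suc m)) (f ∘ isolate i)
      ∎

  -- Terms with an edge into `i`, a loop included, vanish. Row `i` is split off first, then its
  -- diagonal entry, then column `i` of the other rows; what remains free is exactly `r` and `G`.
  sumOver-addSource : ∀ n i (f : Digraph (suc n) → Carrier) →
    (∀ G → isSource G i ≡ false → f G ≈ 0#) →
    sumOver (digraphs (suc n)) f ≈
    sumOver (subsets n) (λ r → sumOver (digraphs n) (λ G → f (addSource i r G)))
  sumOver-addSource n i f f≈0 = begin
    sumOver (digraphs (suc n)) f
      ≈⟨ sumOver-vectors-insertAt (subsets (suc n)) n i f ⟩
    sumOver (subsets (suc n)) (λ r → sumOver (vectors (subsets (suc n)) n) (λ rows → f (insertAt rows i r)))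
      ≈⟨ sumOver-subsets-insertAt n i _ (λ r r∋i → sumOver-zero (vectors (subsets (suc n)) n) (λ rows →
           edge⇒0 (insertAt rows i r) i (≡.trans (cong (λ row → lookup row i) (insertAt-lookup rows i r)) r∋i))) ⟩
    sumOver (subsets n) (λ r → sumOver (vectors (subsets (suc n)) n) (λ rows → f (insertAt rows i (insertAt r i outside))))
      ≈⟨ sumOver-cong (subsets n) (λ r → sumOver-isolate n n i _ (λ rows j row∋i →
           edge⇒0 _ (punchIn i j) (≡.trans (cong (λ row → lookup row i) (insertAt-punchIn rows i _ j)) row∋i))) ⟩
    sumOver (subsets n) (λ r → sumOver (digraphs n) (λ G → f (addSource i r G)))
      ∎
    where
    edge⇒0 : ∀ G j → lookup (lookup G j) i ≡ inside → f G ≈ 0#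
    edge⇒0 G j j→i = f≈0 G (edge-into⇒¬isSource G j j→i)

  product-cong : ∀ {n} {f g : Fin n → Carrier} → (∀ i → f i ≈ g i) → product f ≈ product g
  product-cong f≈g = Π.sum-cong-≋ f≈g

  product-*ˡ : ∀ {n} x (f : Fin n → Carrier) → product (λ i → x * f i) ≈ x ^ n * product f
  product-*ˡ {n} x f = trans (Π.∑-distrib-+ (λ _ → x) f) (*-congʳ (Π.sum-replicate n))

  -- Expansion of a product of binomials: to choose one summand from each factor is to choose a
  -- subset.
  sumOver-subsets-product : ∀ n (g : Fin n → Bool → Carrier) →
    sumOver (subsets n) (λ p → product (λ i → g i (lookup p i))) ≈
    product (λ i → g i outside + g i inside)
  sumOver-subsets-product zero    g = +-identityʳ 1#
  sumOver-subsets-product (suc n) g = begin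
    sumOver (subsets (suc n)) (λ p → product (λ i → g i (lookup p i)))
      ≈⟨ sumOver-vectors-suc sides n (λ p → product (λ i → g i (lookup p i))) ⟩
    sumOver (subsets n) (λ p → g zero outside * h p) + (sumOver (subsets n) (λ p → g zero inside * h p) + 0#)
      ≈⟨ +-cong (sumOver-*ˡ _ (subsets n) h) (+-congʳ (sumOver-*ˡ _ (subsets n) h)) ⟨
    g zero outside * H + (g zero inside * H + 0#)
      ≈⟨ solve 3 (λ a b h → a :* h :+ (b :* h :+ con 0) := (a :+ b) :* h) refl _ _ _ ⟩
    (g zero outside + g zero inside) * H
      ≈⟨ *-congˡ (sumOver-subsets-product n (g ∘ suc)) ⟩
    product (λ i → g i outside + g i inside)
      ∎
    where
    h : Subset n → Carrier
    h p = product (λ i → g (suc i) (lookup p i))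
    H = sumOver (subsets n) h

  ^-count : ∀ {P : A → Set p} (P? : Decidable P) x {n} (v : Vec A n) →
    x ^ Vec.count P? v ≈ product (λ i → if does (P? (lookup v i)) then x else 1#)
  ^-count P? x Vec.[]      = refl
  ^-count P? x (y Vec.∷ v) with does (P? y)
  ... | true  = *-congˡ (^-count P? x v)
  ... | false = trans (^-count P? x v) (sym (*-identityˡ _))

  sourceFactor : Carrier → ∀ {n} → Digraph n → Fin n → Carrier
  sourceFactor t G j = if isSource G j then t else 1#

  -- A product over all vertices can be expanded, and differentiated, vertex by vertex.
  ^-sources : ∀ t {n} (G : Digraph n) → t ^ sources G ≈ product (sourceFactor t G)
  ^-sources t {n} G = trans (^-count (λ j → inDegree G j ℕ.≟ 0) t (Vec.allFin n))
    (product-cong λ i → reflexive (cong (sourceFactor t G) (lookup-allFin i)))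

  ^-size : ∀ t {n} (p : Subset n) → t ^ ∣ p ∣ ≈ product (λ i → if lookup p i then t else 1#)
  ^-size t p = trans (^-count (Bool._≟ inside) t p)
    (product-cong λ i → lemma (lookup p i))
    where
    lemma : ∀ b → (if does (b Bool.≟ inside) then t else 1#) ≈ (if b then t else 1#)
    lemma true  = refl
    lemma false = refl

  -- The coefficient of zⁿ in `DAG t` without its denominator, since a semiring has no division.
  dagSum : Carrier → Carrier → ℕ → Carrier
  dagSum w t n = sumOver (dags n) (λ G → w ^ edges G * t ^ sources G)

  -- The contribution of vertex `i` to the derivative of `t ^ sources G` with respect to `t`: the
  -- factor `t` of a marked source is replaced by 1. The product over the other vertices avoids the
  -- exponent `sources G ∸ 1`.
  markedSource : Carrier → ∀ {n} → Digraph (suc n) → Fin (suc n) → Carrier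
  markedSource t G i = if isSource G i then product (λ j → sourceFactor t G (punchIn i j)) else 0#

  markedSources : Carrier → ∀ {n} → Digraph (suc n) → Carrier
  markedSources t G = sum (markedSource t G)

  -- In a semiring the quotient (t + w)/(1 + w) can only enter through the equation that it
  -- satisfies.
  module _ (w t σ : Carrier) ([1+w]σ≈t+w : (1# + w) * σ ≈ t + w) where
    private
      marked : ∀ {n} → Fin (suc n) → Digraph (suc n) → Carrier
      marked i G = w ^ edges G * markedSource t G i

      -- The factor contributed by a vertex of G which is (b = inside) or is
      -- not (b = outside) an out-neighbour of the added source.
      factor : ∀ {n} → Digraph n → Fin n → Bool → Carrier
      factor G j b = (if b then w else 1#) * (if isSource G j ∧ not b then t else 1#)

      -- The sum is t + w at a source and 1 + w elsewhere; taking out 1 + w from both leaves σ or 1.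
      factor-sum : ∀ {n} (G : Digraph n) j →
        factor G j outside + factor G j inside ≈ (1# + w) * sourceFactor σ G j
      factor-sum G j with isSource G j
      ... | true  = trans (solve 2 (λ t w → con 1 :* t :+ w :* con 1 := t :+ w) refl t w)
                      (sym [1+w]σ≈t+w)
      ... | false = solve 1 (λ w → con 1 :* con 1 :+ w :* con 1 := (con 1 :+ w) :* con 1) refl w

      -- The new edges contribute `w ^ ∣ r ∣`, which is spread over the old vertices as one `w` for
      -- each member of `r`.
      marked-addSource : ∀ {n} i r (G : Digraph n) →
        marked i (addSource i r G) ≈ w ^ edges G * product (λ j → factor G j (lookup r j))
      marked-addSource i r G = begin
        marked i (addSource i r G)
          ≡⟨ cong (λ b → w ^ edges (addSource i r G) *
               (if b then product (λ j → sourceFactor t (addSource i r G) (punchIn i j)) else 0#))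
               (isSource-new i r G) ⟩
        w ^ edges (addSource i r G) * product (λ j → sourceFactor t (addSource i r G) (punchIn i j))
          ≈⟨ *-cong (trans (^-congʳ w (edges-addSource i r G)) (^-homo-* w ∣ r ∣ (edges G)))
               (product-cong λ j → reflexive (cong (λ b → if b then t else 1#) (isSource-old i r G j))) ⟩
        w ^ ∣ r ∣ * w ^ edges G * product (λ j → if isSource G j ∧ not (lookup r j) then t else 1#)
          ≈⟨ solve 3 (λ a b c → a :* b :* c := b :* (a :* c)) refl _ _ _ ⟩
        w ^ edges G * (w ^ ∣ r ∣ * product (λ j → if isSource G j ∧ not (lookup r j) then t else 1#))
          ≈⟨ *-congˡ (*-congʳ (^-size w r)) ⟩
        w ^ edges G * (product (λ j → if lookup r j then w else 1#) *
          product (λ j → if isSource G j ∧ not (lookup r j) then t else 1#))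
          ≈⟨ *-congˡ (Π.∑-distrib-+ (λ j → if lookup r j then w else 1#) _) ⟨
        w ^ edges G * product (λ j → factor G j (lookup r j))
          ∎

      if-acyclic : ∀ {n} → Digraph n → Carrier → Carrier
      if-acyclic G x = if does (acyclic? G) then x else 0#

      if-cong : ∀ b {x y} → x ≈ y → (if b then x else 0#) ≈ (if b then y else 0#)
      if-cong true  x≈y = x≈y
      if-cong false x≈y = refl

      if-sumOver : ∀ b (xs : List A) f → sumOver xs (λ x → if b then f x else 0#) ≈ (if b then sumOver xs f else 0#)
      if-sumOver true  xs f = refl
      if-sumOver false xs f = sumOver-zero xs (λ _ → refl)

      if-0 : ∀ b → (if b then 0# else 0#) ≈ 0#
      if-0 true  = refl
      if-0 false = refl

      if-* : ∀ b x {y} → (if b then x * y else 0#) ≈ x * (if b then y else 0#)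
      if-* true  x = refl
      if-* false x = sym (zeroʳ x)

      sum-out-neighbours : ∀ {n} (G : Digraph n) →
        sumOver (subsets n) (λ r → w ^ edges G * product (λ j → factor G j (lookup r j))) ≈
        (1# + w) ^ n * (w ^ edges G * σ ^ sources G)
      sum-out-neighbours {n} G = begin
        sumOver (subsets n) (λ r → w ^ edges G * product (λ j → factor G j (lookup r j)))
          ≈⟨ sumOver-*ˡ _ (subsets n) _ ⟨
        w ^ edges G * sumOver (subsets n) (λ r → product (λ j → factor G j (lookup r j)))
          ≈⟨ *-congˡ (sumOver-subsets-product n (factor G)) ⟩
        w ^ edges G * product (λ j → factor G j outside + factor G j inside)
          ≈⟨ *-congˡ (product-cong (factor-sum G)) ⟩
        w ^ edges G * product (λ j → (1# + w) * sourceFactor σ G j)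
          ≈⟨ *-congˡ (product-*ˡ (1# + w) (sourceFactor σ G)) ⟩
        w ^ edges G * ((1# + w) ^ n * product (sourceFactor σ G))
          ≈⟨ *-congˡ (*-congˡ (^-sources σ G)) ⟨
        w ^ edges G * ((1# + w) ^ n * σ ^ sources G)
          ≈⟨ solve 3 (λ a b c → a :* (b :* c) := b :* (a :* c)) refl _ _ _ ⟩
        (1# + w) ^ n * (w ^ edges G * σ ^ sources G)
          ∎

      sumOver-marked : ∀ {n} i → sumOver (dags (suc n)) (marked i) ≈ (1# + w) ^ n * dagSum w σ n
      sumOver-marked {n} i = begin
        sumOver (dags (suc n)) (marked i)
          ≈⟨ sumOver-filter acyclic? (digraphs (suc n)) (marked i) ⟩
        sumOver (digraphs (suc n)) (λ G → if-acyclic G (marked i G))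
          ≈⟨ sumOver-addSource n i _ (λ G ¬source → trans
               (if-cong (does (acyclic? G)) (trans (*-congˡ (reflexive (cong (λ b → if b then
                 product (λ j → sourceFactor t G (punchIn i j)) else 0#) ¬source))) (zeroʳ _)))
               (if-0 (does (acyclic? G)))) ⟩
        sumOver (subsets n) (λ r → sumOver (digraphs n) (λ G →
          if-acyclic (addSource i r G) (marked i (addSource i r G))))
          ≈⟨ sumOver-cong (subsets n) (λ r → sumOver-cong (digraphs n) (λ G → trans
               (reflexive (cong (λ b → if b then marked i (addSource i r G) else 0#) (acyclic?-addSource i r G)))
               (if-cong (does (acyclic? G)) (marked-addSource i r G)))) ⟩
        sumOver (subsets n) (λ r → sumOver (digraphs n) (λ G →
          if-acyclic G (w ^ edges G * product (λ j → factor G j (lookup r j)))))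
          -- Acyclicity now depends on `G` alone, so with `G` outermost the sum over `r` is
          -- unconditional.
          ≈⟨ sumOver-swap (subsets n) (digraphs n) _ ⟩
        sumOver (digraphs n) (λ G → sumOver (subsets n) (λ r →
          if-acyclic G (w ^ edges G * product (λ j → factor G j (lookup r j)))))
          ≈⟨ sumOver-cong (digraphs n) (λ G → trans (if-sumOver (does (acyclic? G)) (subsets n) _)
               (trans (if-cong (does (acyclic? G)) (sum-out-neighbours G)) (if-* (does (acyclic? G)) _))) ⟩
        sumOver (digraphs n) (λ G → (1# + w) ^ n * if-acyclic G (w ^ edges G * σ ^ sources G))
          ≈⟨ sumOver-*ˡ _ (digraphs n) _ ⟨
        (1# + w) ^ n * sumOver (digraphs n) (λ G → if-acyclic G (w ^ edges G * σ ^ sources G))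
          ≈⟨ *-congˡ (sumOver-filter acyclic? (digraphs n) _) ⟨
        (1# + w) ^ n * dagSum w σ n
          ∎

    -- The sum for a fixed marked vertex `i` is the same for each of the n + 1 choices of `i`.
    sumOver-markedSources : ∀ n →
      sumOver (dags (suc n)) (λ G → w ^ edges G * markedSources t G) ≈
      suc n · ((1# + w) ^ n * dagSum w σ n)
    sumOver-markedSources n = begin
      sumOver (dags (suc n)) (λ G → w ^ edges G * markedSources t G)
        ≈⟨ sumOver-cong (dags (suc n)) (λ G → *-distribˡ-sum (w ^ edges G) (markedSource t G)) ⟩
      sumOver (dags (suc n)) (λ G → sum (λ i → marked i G))
        ≈⟨ sumOver-sum (dags (suc n)) (λ G i → marked i G) ⟩
      sum {suc n} (λ i → sumOver (dags (suc n)) (marked i))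
        ≈⟨ sum-cong-≋ (sumOver-marked {n}) ⟩
      sum {suc n} (λ _ → (1# + w) ^ n * dagSum w σ n)
        ≈⟨ sum-replicate (suc n) ⟩
      suc n · ((1# + w) ^ n * dagSum w σ n)
        ∎

  product-zero : ∀ {n} (f : Fin n → Carrier) j → f j ≈ 0# → product f ≈ 0#
  product-zero {suc n} f j fj≈0 = begin
    product f                                   ≈⟨ Π.sum-remove {i = j} f ⟩
    f j * product (λ i → f (punchIn j i))       ≈⟨ *-congʳ fj≈0 ⟩
    0# * product (λ i → f (punchIn j i))        ≈⟨ zeroˡ _ ⟩
    0#                                          ∎

  dagSum-0 : ∀ w n → dagSum w 0# (suc n) ≈ 0#
  dagSum-0 w n = trans (sumOver-filter acyclic? (digraphs (suc n)) _)
    (sumOver-zero (digraphs (suc n)) term)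
    where
    term : ∀ G → (if does (acyclic? G) then w ^ edges G * 0# ^ sources G else 0#) ≈ 0#
    -- Passing the decision as an argument lets one match settle the value of `does` and provide the
    -- proof of acyclicity.
    term G = case (acyclic? G)
      where
      case : (acyclic : Dec (Acyclic G)) → (if does acyclic then w ^ edges G * 0# ^ sources G else 0#) ≈ 0#
      case (no  _)       = refl
      case (yes acyclic) = let j , source = acyclic⇒source G acyclic in begin
        w ^ edges G * 0# ^ sources G              ≈⟨ *-congˡ (^-sources 0# G) ⟩
        w ^ edges G * product (sourceFactor 0# G) ≈⟨ *-congˡ (product-zero (sourceFactor 0# G) j (reflexive
          (cong (λ b → if b then 0# else 1#) (dec-true (inDegree G j ℕ.≟ 0) source)))) ⟩
        w ^ edges G * 0#                          ≈⟨ zeroʳ _ ⟩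
        0#                                        ∎

-- Quotients of the denominators, and characteristic 0

module Denominators {c ℓ₁ ℓ₂ ℓ₃} (F : OrderedField c ℓ₁ ℓ₂ ℓ₃)
  (w : OrderedField.Carrier F) (0<w : OrderedField._<_ F (OrderedField.0# F) w)
  where

  open OrderedField F
  open GraphicGeneratingFunction F w 0<w using (denominator; 0<denominator)
  open import Algebra.Properties.Semiring.Exp (CommutativeRing.semiring commutativeRing)
    using (^-homo-*; ^-congʳ)
  open import Algebra.Properties.Semiring.Mult (CommutativeRing.semiring commutativeRing)
    using (×-assoc-*; ×-congʳ; ×1-homo-*)
  open import Relation.Binary.Reasoning.Setoid setoid
  open import Algebra.Solver.Ring.NaturalCoefficients.Default
    (CommutativeRing.commutativeSemiring commutativeRing) using (solve; _:=_; _:*_)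

  1/denominator : ℕ → Carrier
  1/denominator n = recip (denominator n) (0<denominator n)

  -- The exponent of 1 + w grows by n, by Pascal's rule, and the factorial gains the factor n + 1.
  denominator-suc : ∀ n → denominator (suc n) ≈ (suc n · 1# * (1# + w) ^ n) * denominator n
  denominator-suc n = begin
    (1# + w) ^ (suc n C 2) * ((suc n !) · 1#)
      ≈⟨ *-cong (^-congʳ (1# + w) (≡.trans (≡.sym (nCk+nC[k+1]≡[n+1]C[k+1] n 1)) (≡.cong (ℕ._+ (n C 2)) (nC1≡n n))))
           (×1-homo-* (suc n) (n !)) ⟩
    (1# + w) ^ (n ℕ.+ n C 2) * (suc n · 1# * (n !) · 1#)
      ≈⟨ *-congʳ (^-homo-* (1# + w) n (n C 2)) ⟩
    (1# + w) ^ n * (1# + w) ^ (n C 2) * (suc n · 1# * (n !) · 1#)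
      ≈⟨ solve 4 (λ a b c d → a :* b :* (c :* d) := (c :* a) :* (b :* d)) refl _ _ _ _ ⟩
    (suc n · 1# * (1# + w) ^ n) * denominator n
      ∎

  -- Absorbs the two factors that `sumOver-markedSources` produces.
  1/denominator-suc : ∀ n → 1/denominator (suc n) * (suc n · 1# * (1# + w) ^ n) ≈ 1/denominator n
  1/denominator-suc n = begin
    r′ * x                          ≈⟨ *-identityʳ _ ⟨
    r′ * x * 1#                     ≈⟨ *-congˡ (recip-inverseˡ (denominator n) (0<denominator n)) ⟨
    r′ * x * (r * denominator n)    ≈⟨ solve 4 (λ a b c d → a :* b :* (c :* d) := a :* (b :* d) :* c) refl _ _ _ _ ⟩
    r′ * (x * denominator n) * r    ≈⟨ *-congʳ (*-congˡ (denominator-suc n)) ⟨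
    r′ * denominator (suc n) * r    ≈⟨ *-congʳ (recip-inverseˡ (denominator (suc n)) (0<denominator (suc n))) ⟩
    1# * r                          ≈⟨ *-identityˡ r ⟩
    r                               ∎
    where
    x = suc n · 1# * (1# + w) ^ n
    r = 1/denominator n
    r′ = 1/denominator (suc n)

  1/denominator-0 : 1/denominator 0 ≈ 1#
  1/denominator-0 = begin
    1/denominator 0                  ≈⟨ *-identityʳ _ ⟨
    1/denominator 0 * 1#             ≈⟨ *-congˡ (trans (*-identityˡ _) (+-identityʳ 1#)) ⟨
    1/denominator 0 * denominator 0  ≈⟨ recip-inverseˡ (denominator 0) (0<denominator 0) ⟩
    1#                               ∎

  -- The order forces characteristic 0: `suc n · 1#` is positive, hence invertible.
  ·-cancelˡ : ∀ n {x y} → suc n · x ≈ suc n · y → x ≈ y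
  ·-cancelˡ n {x} {y} nx≈ny = begin
    x                  ≈⟨ divide x ⟨
    r * (suc n · x)    ≈⟨ *-congˡ nx≈ny ⟩
    r * (suc n · y)    ≈⟨ divide y ⟩
    y                  ∎
    where
    0<n : 0# < suc n · 1#
    0<n = ·-pos 0<1 {suc n} (ℕ.s≤s ℕ.z≤n)
    r = recip (suc n · 1#) 0<n
    divide : ∀ x → r * (suc n · x) ≈ x
    divide x = begin
      r * (suc n · x)         ≈⟨ *-congˡ (×-congʳ (suc n) (*-identityˡ x)) ⟨
      r * (suc n · (1# * x))  ≈⟨ *-congˡ (×-assoc-* (suc n) 1# x) ⟨
      r * (suc n · 1# * x)    ≈⟨ *-assoc r _ x ⟨
      r * (suc n · 1#) * x    ≈⟨ *-congʳ (recip-inverseˡ (suc n · 1#) 0<n) ⟩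
      1# * x                  ≈⟨ *-identityˡ x ⟩
      x                       ∎

-- The derivative of the generating function

module DAGSeries {c ℓ₁ ℓ₂ ℓ₃} (F : OrderedField c ℓ₁ ℓ₂ ℓ₃)
  (w : OrderedField.Carrier F) (0<w : OrderedField._<_ F (OrderedField.0# F) w)
  where

  private
    module F = OrderedField F

  open GraphicGeneratingFunction F w 0<w
  open PolynomialSemiring F.commutativeRing
  open Calculus F.commutativeRing
  open CommutativeSemiring polyCommutativeSemiring hiding (zero)
  open Denominators F w 0<w
  open SourceMarking polyCommutativeSemiring
  open import Algebra.Solver.Ring.NaturalCoefficients.Default polyCommutativeSemiring
  open import Algebra.Properties.Semiring.Exp semiring using (_^_; ^-congˡ)
  open import Algebra.Properties.Semiring.Mult semiring using () renaming (_×_ to _·_)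
  open import Algebra.Properties.Semiring.Sum semiring using (sum; sum-cong-≋; *-distribˡ-sum; sum-replicate-zero)
  open RawSemiringDefinitions polyRawSemiring using () renaming (_^_ to _^ₚ_)

  private
    W Q : Poly
    W = constₚ w
    Q = constₚ 1/[1+w]

  open import Relation.Binary.Reasoning.Setoid setoid

  -- The derivative determines each coefficient of positive degree up to a cancellable multiple, and
  -- the value at 0 is the constant coefficient.
  derivative-injective : ∀ {p q} → derivative p ≈ derivative q → p ∘ₚ 0# ≈ q ∘ₚ 0# → p ≈ q
  derivative-injective {p} {q} p′≈q′ p₀≈q₀ .at zero =
    F.trans (F.sym (coeff-∘ₚ-0 p)) (F.trans (p₀≈q₀ .at 0) (coeff-∘ₚ-0 q))
  derivative-injective {p} {q} p′≈q′ p₀≈q₀ .at (suc k) = ·-cancelˡ k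
    (F.trans (F.sym (coeff-derivative p k)) (F.trans (p′≈q′ .at k) (coeff-derivative q k)))

  ·-constₚ : ∀ n p → n · p ≈ constₚ (n F.· F.1#) * p
  ·-constₚ zero    p = sym (*-congʳ {p} constₚ-0)
  ·-constₚ (suc n) p = begin
    p + n · p                          ≈⟨ +-congˡ {p} (·-constₚ n p) ⟩
    p + constₚ (n F.· F.1#) * p        ≈⟨ +-congʳ {constₚ (n F.· F.1#) * p} (*-identityˡ p) ⟨
    1# * p + constₚ (n F.· F.1#) * p   ≈⟨ distribʳ p 1# (constₚ (n F.· F.1#)) ⟨
    (1# + constₚ (n F.· F.1#)) * p     ∎

  -- The two powers recurse over semiring records with different equalities, so that they agree by
  -- induction and not by computation.
  ^ₚ≡^ : ∀ p n → p ^ₚ n ≡ p ^ n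
  ^ₚ≡^ p zero    = ≡.refl
  ^ₚ≡^ p (suc n) = ≡.cong (p *_) (^ₚ≡^ p n)

  derivative-sumOver : ∀ {a} {A : Set a} (xs : List A) (f : A → Poly) →
    derivative (sumOver xs f) ≈ sumOver xs (derivative ∘ f)
  derivative-sumOver []       f = refl
  derivative-sumOver (x ∷ xs) f =
    trans (derivative-+ (f x) (sumOver xs f)) (+-congˡ {derivative (f x)} (derivative-sumOver xs f))

  ∘ₚ-sumOver : ∀ {a} {A : Set a} (xs : List A) (f : A → Poly) s →
    sumOver xs f ∘ₚ s ≈ sumOver xs (λ x → f x ∘ₚ s)
  ∘ₚ-sumOver []       f s = refl
  ∘ₚ-sumOver (x ∷ xs) f s =
    trans (∘ₚ-+ (f x) (sumOver xs f) s) (+-congˡ {f x ∘ₚ s} (∘ₚ-sumOver xs f s))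

  -- Leibniz's rule for several factors; `punchIn i` runs through the indices other than `i`.
  derivative-product : ∀ {n} (f : Fin (suc n) → Poly) →
    derivative (product f) ≈ sum (λ i → derivative (f i) * product (λ j → f (punchIn i j)))
  derivative-product {zero} f = begin
    derivative (f zero * 1#)                       ≈⟨ derivative-* (f zero) 1# ⟩
    derivative (f zero) * 1# + f zero * 0#         ≈⟨ +-congˡ {derivative (f zero) * 1#} (zeroʳ (f zero)) ⟩
    derivative (f zero) * 1# + 0#                  ∎
  derivative-product {suc n} f = begin
    derivative (f zero * product (f ∘ suc))
      ≈⟨ derivative-* (f zero) (product (f ∘ suc)) ⟩
    d₀ + f zero * derivative (product (f ∘ suc))
      ≈⟨ +-congˡ {d₀} (*-congˡ {f zero} (derivative-product (f ∘ suc))) ⟩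
    d₀ + f zero * sum (λ i → d i * rest i)
      ≈⟨ +-congˡ {d₀} (*-distribˡ-sum (f zero) (λ i → d i * rest i)) ⟩
    d₀ + sum (λ i → f zero * (d i * rest i))
      ≈⟨ +-congˡ {d₀} (sum-cong-≋ (λ i → solve 3 (λ a b c → a :* (b :* c) := b :* (a :* c)) refl
           (f zero) (d i) (rest i))) ⟩
    d₀ + sum (λ i → d i * (f zero * rest i))
      ∎
    where
    d₀ = derivative (f zero) * product (f ∘ suc)
    d rest : Fin (suc n) → Poly
    d i = derivative (f (suc i))
    rest i = product (λ j → f (suc (punchIn i j)))

  derivative-^-sources : ∀ t {n} (G : Digraph (suc n)) →
    derivative (t ^ sources G) ≈ derivative t * markedSources t G
  derivative-^-sources t G = begin
    derivative (t ^ sources G)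
      ≈⟨ derivative-cong (^-sources t G) ⟩
    derivative (product (sourceFactor t G))
      ≈⟨ derivative-product (sourceFactor t G) ⟩
    sum (λ i → derivative (sourceFactor t G i) * product (λ j → sourceFactor t G (punchIn i j)))
      ≈⟨ sum-cong-≋ (λ i → lemma (isSource G i) (product (λ j → sourceFactor t G (punchIn i j)))) ⟩
    sum (λ i → derivative t * markedSource t G i)
      ≈⟨ *-distribˡ-sum (derivative t) (markedSource t G) ⟨
    derivative t * markedSources t G
      ∎
    where
    lemma : ∀ b x → derivative (if b then t else 1#) * x ≈ derivative t * (if b then x else 0#)
    lemma true  x = refl
    -- The factor of a vertex that is not a source is `1#`, whose derivative computes to `[]`.
    lemma false x = sym (zeroʳ (derivative t))

  DAG-term : ∀ t n (G : Digraph n) →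
    constₚ (w F.^ edges G F.* 1/denominator n) * t ^ₚ sources G ≈
    constₚ (1/denominator n) * (W ^ edges G * t ^ sources G)
  DAG-term t n G = begin
    constₚ (w F.^ edges G F.* 1/denominator n) * t ^ₚ sources G
      ≈⟨ *-cong (trans (constₚ-homo-* _ _) (*-congʳ {constₚ (1/denominator n)} (constₚ-homo-^ w (edges G))))
           (reflexive (^ₚ≡^ t (sources G))) ⟩
    W ^ edges G * constₚ (1/denominator n) * t ^ sources G
      ≈⟨ solve 3 (λ a b c → a :* b :* c := b :* (a :* c)) refl
           (W ^ edges G) (constₚ (1/denominator n)) (t ^ sources G) ⟩
    constₚ (1/denominator n) * (W ^ edges G * t ^ sources G)
      ∎

  DAG≈dagSum : ∀ t n → DAG t n ≈ constₚ (1/denominator n) * dagSum W t n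
  DAG≈dagSum t n = trans (sumOver-cong (dags n) (DAG-term t n))
    (sym (sumOver-*ˡ (constₚ (1/denominator n)) (dags n) _))

  DAG-cong : ∀ {s t} n → s ≈ t → DAG s n ≈ DAG t n
  DAG-cong {s} {t} n s≈t = sumOver-cong (dags n) λ G →
    *-congˡ {constₚ (w F.^ edges G F.* 1/denominator n)}
      (trans (reflexive (^ₚ≡^ s (sources G)))
        (trans (^-congˡ (sources G) s≈t) (sym (reflexive (^ₚ≡^ t (sources G))))))

  -- Graph weights are constants, so substitution reaches only the argument `t`. This is what allows
  -- an identity in `u` to be read at σ(u) or at 0.
  DAG-∘ₚ : ∀ t n s → DAG t n ∘ₚ s ≈ DAG (t ∘ₚ s) n
  DAG-∘ₚ t n s = trans (∘ₚ-sumOver (dags n) _ s) (sumOver-cong (dags n) λ G → begin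
    (constₚ (coefficient G) * t ^ₚ sources G) ∘ₚ s
      ≈⟨ ∘ₚ-* (constₚ (coefficient G)) (t ^ₚ sources G) s ⟩
    (constₚ (coefficient G) ∘ₚ s) * ((t ^ₚ sources G) ∘ₚ s)
      ≈⟨ *-cong (constₚ-∘ₚ (coefficient G) s) (reflexive (≡.cong (_∘ₚ s) (^ₚ≡^ t (sources G)))) ⟩
    constₚ (coefficient G) * ((t ^ sources G) ∘ₚ s)
      ≈⟨ *-congˡ {constₚ (coefficient G)} (∘ₚ-^ t (sources G) s) ⟩
    constₚ (coefficient G) * (t ∘ₚ s) ^ sources G
      ≡⟨ ≡.cong (constₚ (coefficient G) *_) (^ₚ≡^ (t ∘ₚ s) (sources G)) ⟨
    constₚ (coefficient G) * (t ∘ₚ s) ^ₚ sources G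
      ∎)
    where
    coefficient : Digraph n → F.Carrier
    coefficient G = w F.^ edges G F.* 1/denominator n

  DAG-zero : ∀ t → DAG t 0 ≈ 1#
  DAG-zero t = begin
    constₚ (F.1# F.* 1/denominator 0) * 1# + 0#  ≈⟨ +-identityʳ _ ⟩
    constₚ (F.1# F.* 1/denominator 0) * 1#       ≈⟨ *-identityʳ _ ⟩
    constₚ (F.1# F.* 1/denominator 0)            ≈⟨ constₚ-cong (F.trans (F.*-identityˡ _) 1/denominator-0) ⟩
    1#                                           ∎

  DAG-0 : ∀ n → DAG 0# (suc n) ≈ 0#
  DAG-0 n = trans (DAG≈dagSum 0# (suc n))
    (trans (*-congˡ {constₚ (1/denominator (suc n))} (dagSum-0 W n)) (zeroʳ (constₚ (1/denominator (suc n)))))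

  -- (t + w) / (1 + w)
  shift : Poly → Poly
  shift t = constₚ (w F.* 1/[1+w]) + Q * t

  [1+W]*shift : ∀ t → (1# + W) * shift t ≈ t + W
  [1+W]*shift t = begin
    (1# + W) * (constₚ (w F.* 1/[1+w]) + Q * t)
      ≈⟨ *-congˡ {1# + W} (+-congʳ {Q * t} (constₚ-homo-* w 1/[1+w])) ⟩
    (1# + W) * (W * Q + Q * t)
      ≈⟨ solve 4 (λ a w q t → a :* (w :* q :+ q :* t) := (q :* a) :* (t :+ w)) refl (1# + W) W Q t ⟩
    (Q * (1# + W)) * (t + W)
      ≈⟨ *-congʳ {t + W} (trans (sym (constₚ-homo-* 1/[1+w] (F.1# F.+ w)))
           (constₚ-cong (F.recip-inverseˡ (F.1# F.+ w) 0<1+w))) ⟩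
    1# * (t + W)
      ≈⟨ *-identityˡ (t + W) ⟩
    t + W
      ∎

  -- The formula for ∂D(t) at zⁿ⁺¹; the factor z on its right-hand side lowers the index by one.
  derivative-DAG-suc : ∀ t n → derivative (DAG t (suc n)) ≈ derivative t * DAG (shift t) n
  derivative-DAG-suc t n = begin
    derivative (DAG t (suc n))
      ≈⟨ derivative-cong (sumOver-cong (dags (suc n)) (DAG-term t (suc n))) ⟩
    derivative (sumOver (dags (suc n)) (λ G → R′ * (W ^ edges G * t ^ sources G)))
      ≈⟨ derivative-sumOver (dags (suc n)) _ ⟩
    sumOver (dags (suc n)) (λ G → derivative (R′ * (W ^ edges G * t ^ sources G)))
      ≈⟨ sumOver-cong (dags (suc n)) term ⟩
    sumOver (dags (suc n)) (λ G → derivative t * R′ * (W ^ edges G * markedSources t G))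
      ≈⟨ sumOver-*ˡ (derivative t * R′) (dags (suc n)) _ ⟨
    derivative t * R′ * sumOver (dags (suc n)) (λ G → W ^ edges G * markedSources t G)
      ≈⟨ *-congˡ {derivative t * R′} (sumOver-markedSources W t (shift t) ([1+W]*shift t) n) ⟩
    derivative t * R′ * (suc n · ((1# + W) ^ n * D))
      ≈⟨ *-congˡ {derivative t * R′} (trans (·-constₚ (suc n) ((1# + W) ^ n * D))
           (*-congˡ {N} (*-congʳ {D} (sym (constₚ-homo-^ (F.1# F.+ w) n))))) ⟩
    derivative t * R′ * (N * (P * D))
      ≈⟨ solve 5 (λ t r n p d → t :* r :* (n :* (p :* d)) := t :* ((r :* (n :* p)) :* d)) refl
           (derivative t) R′ N P D ⟩
    derivative t * ((R′ * (N * P)) * D)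
      ≈⟨ *-congˡ {derivative t} (*-congʳ {D} scalar) ⟩
    derivative t * (constₚ (1/denominator n) * D)
      ≈⟨ *-congˡ {derivative t} (DAG≈dagSum (shift t) n) ⟨
    derivative t * DAG (shift t) n
      ∎
    where
    R′ = constₚ (1/denominator (suc n))
    D = dagSum W (shift t) n
    N = constₚ (suc n F.· F.1#)
    P = constₚ ((F.1# F.+ w) F.^ n)

    scalar : R′ * (N * P) ≈ constₚ (1/denominator n)
    scalar = trans (*-congˡ {R′} (sym (constₚ-homo-* (suc n F.· F.1#) ((F.1# F.+ w) F.^ n))))
      (trans (sym (constₚ-homo-* (1/denominator (suc n)) _)) (constₚ-cong (1/denominator-suc n)))

    term : ∀ G → derivative (R′ * (W ^ edges G * t ^ sources G)) ≈
                 derivative t * R′ * (W ^ edges G * markedSources t G)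
    term G = begin
      derivative (R′ * (W ^ edges G * t ^ sources G))
        ≈⟨ derivative-const* (1/denominator (suc n)) (W ^ edges G * t ^ sources G) ⟩
      R′ * derivative (W ^ edges G * t ^ sources G)
        ≈⟨ *-congˡ {R′} (trans (derivative-cong (*-congʳ {t ^ sources G} (sym (constₚ-homo-^ w (edges G)))))
             (trans (derivative-const* (w F.^ edges G) (t ^ sources G))
               (*-congʳ {derivative (t ^ sources G)} (constₚ-homo-^ w (edges G))))) ⟩
      R′ * (W ^ edges G * derivative (t ^ sources G))
        ≈⟨ *-congˡ {R′} (*-congˡ {W ^ edges G} (derivative-^-sources t G)) ⟩
      R′ * (W ^ edges G * (derivative t * markedSources t G))
        ≈⟨ solve 4 (λ r w t m → r :* (w :* (t :* m)) := t :* r :* (w :* m)) refl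
             R′ (W ^ edges G) (derivative t) (markedSources t G) ⟩
      derivative t * R′ * (W ^ edges G * markedSources t G)
        ∎

  ^ₚ-const : ∀ a n → constₚ a ^ₚ n ≈ constₚ (a F.^ n)
  ^ₚ-const a n = trans (reflexive (^ₚ≡^ (constₚ a) n)) (sym (constₚ-homo-^ a n))

  derivative-u : derivative u ≈ 1#
  derivative-u .at zero    = F.+-identityʳ F.1#
  derivative-u .at (suc k) = F.refl

  derivative-shift-u : derivative (shift u) ≈ Q
  derivative-shift-u = begin
    derivative (shift u)              ≈⟨ derivative-+ (constₚ (w F.* 1/[1+w])) (Q * u) ⟩
    derivative (Q * u)                ≈⟨ derivative-const* 1/[1+w] u ⟩
    Q * derivative u                  ≈⟨ *-congˡ {Q} derivative-u ⟩
    Q * 1#                            ≈⟨ *-identityʳ Q ⟩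
    Q                                 ∎

  shift-∘ₚ : ∀ t s → shift t ∘ₚ s ≈ shift (t ∘ₚ s)
  shift-∘ₚ t s = begin
    (V + Q * t) ∘ₚ s                 ≈⟨ ∘ₚ-+ V (Q * t) s ⟩
    V ∘ₚ s + (Q * t) ∘ₚ s            ≈⟨ +-cong (constₚ-∘ₚ _ s) (trans (∘ₚ-* Q t s) (*-congʳ {t ∘ₚ s} (constₚ-∘ₚ _ s))) ⟩
    V + Q * (t ∘ₚ s)                 ∎
    where V = constₚ (w F.* 1/[1+w])

  -- The two factors of the right-hand side

  A B : Series
  A = DAG u ⟨ Q z⟩
  B = DAG (constₚ (w F.* 1/[1+w]))

  A-zero : A 0 ≈ 1#
  A-zero = trans (*-identityˡ (DAG u 0)) (DAG-zero u)

  derivative-A-zero : derivative (A 0) ≈ 0#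
  derivative-A-zero = derivative-cong A-zero

  A-∘ₚ-shift : ∀ n → A n ∘ₚ shift u ≈ Q ^ₚ n * DAG (shift u) n
  A-∘ₚ-shift n = begin
    (Q ^ₚ n * DAG u n) ∘ₚ shift u
      ≈⟨ ∘ₚ-* (Q ^ₚ n) (DAG u n) (shift u) ⟩
    ((Q ^ₚ n) ∘ₚ shift u) * (DAG u n ∘ₚ shift u)
      ≈⟨ *-cong
           (trans (∘ₚ-cong (shift u) (^ₚ-const 1/[1+w] n))
             (trans (constₚ-∘ₚ (1/[1+w] F.^ n) (shift u)) (sym (^ₚ-const 1/[1+w] n))))
           (trans (DAG-∘ₚ u n (shift u)) (DAG-cong n (X-∘ₚ (shift u)))) ⟩
    Q ^ₚ n * DAG (shift u) n
      ∎

  -- One factor of `Q ^ₚ suc n` is split off; it stands where the slope of σ stands in the recursion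
  -- for `DAG (shift u)`.
  derivative-A-suc : ∀ n → derivative (A (suc n)) ≈ Q * (A n ∘ₚ shift u)
  derivative-A-suc n = begin
    derivative (Q ^ₚ suc n * DAG u (suc n))
      ≈⟨ derivative-cong (*-congʳ {DAG u (suc n)} (^ₚ-const 1/[1+w] (suc n))) ⟩
    derivative (constₚ (1/[1+w] F.^ suc n) * DAG u (suc n))
      ≈⟨ derivative-const* (1/[1+w] F.^ suc n) (DAG u (suc n)) ⟩
    constₚ (1/[1+w] F.^ suc n) * derivative (DAG u (suc n))
      ≈⟨ *-cong (sym (^ₚ-const 1/[1+w] (suc n)))
           (trans (derivative-DAG-suc u n)
             (trans (*-congʳ {DAG (shift u) n} derivative-u) (*-identityˡ (DAG (shift u) n)))) ⟩
    Q * Q ^ₚ n * DAG (shift u) n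
      ≈⟨ *-assoc Q (Q ^ₚ n) (DAG (shift u) n) ⟩
    Q * (Q ^ₚ n * DAG (shift u) n)
      ≈⟨ *-congˡ {Q} (A-∘ₚ-shift n) ⟨
    Q * (A n ∘ₚ shift u)
      ∎

  A-suc-0 : ∀ n → A (suc n) ∘ₚ 0# ≈ 0#
  A-suc-0 n = begin
    (Q ^ₚ suc n * DAG u (suc n)) ∘ₚ 0#               ≈⟨ ∘ₚ-* (Q ^ₚ suc n) (DAG u (suc n)) 0# ⟩
    ((Q ^ₚ suc n) ∘ₚ 0#) * (DAG u (suc n) ∘ₚ 0#)     ≈⟨ *-congˡ {(Q ^ₚ suc n) ∘ₚ 0#}
      (trans (DAG-∘ₚ u (suc n) 0#) (trans (DAG-cong (suc n) (X-∘ₚ 0#)) (DAG-0 n))) ⟩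
    ((Q ^ₚ suc n) ∘ₚ 0#) * 0#                        ≈⟨ zeroʳ ((Q ^ₚ suc n) ∘ₚ 0#) ⟩
    0#                                               ∎

  B-∘ₚ : ∀ n s → B n ∘ₚ s ≈ B n
  B-∘ₚ n s = trans (DAG-∘ₚ _ n s) (DAG-cong n (constₚ-∘ₚ _ s))

  -- The argument of `B` is a constant, whose derivative computes to `[]` and annihilates the
  -- right-hand side of `derivative-DAG-suc`.
  derivative-B : ∀ n → derivative (B n) ≈ 0#
  derivative-B zero    = derivative-cong (DAG-zero (constₚ (w F.* 1/[1+w])))
  derivative-B (suc n) = derivative-DAG-suc (constₚ (w F.* 1/[1+w])) n

  derivative-*B : ∀ p n → derivative (p * B n) ≈ derivative p * B n
  derivative-*B p n = begin
    derivative (p * B n)                       ≈⟨ derivative-* p (B n) ⟩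
    derivative p * B n + p * derivative (B n)  ≈⟨ +-congˡ {derivative p * B n} (*-congˡ {p} (derivative-B n)) ⟩
    derivative p * B n + p * 0#                ≈⟨ +-congˡ {derivative p * B n} (zeroʳ p) ⟩
    derivative p * B n + 0#                    ≈⟨ +-identityʳ (derivative p * B n) ⟩
    derivative p * B n                         ∎

  ⊛B-∘ₚ : ∀ f n s → (f ⊛ B) n ∘ₚ s ≈ ((λ k → f k ∘ₚ s) ⊛ B) n
  ⊛B-∘ₚ f n s = trans (∘ₚ-sum {suc n} (λ i → f (toℕ i) * B (n ∸ toℕ i)) s)
    (sum-cong-≋ {suc n} λ i → trans (∘ₚ-* (f (toℕ i)) (B (n ∸ toℕ i)) s)
      (*-congˡ {f (toℕ i) ∘ₚ s} (B-∘ₚ (n ∸ toℕ i) s)))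

  -- The term with `A 0` is constant in `u` and drops out; the others, reindexed by one, form the
  -- convolution at n.
  derivative-A⊛B-suc : ∀ n → derivative ((A ⊛ B) (suc n)) ≈ Q * ((A ⊛ B) n ∘ₚ shift u)
  derivative-A⊛B-suc n = begin
    derivative ((A ⊛ B) (suc n))
      ≈⟨ derivative-+ (A 0 * B (suc n)) tail ⟩
    derivative (A 0 * B (suc n)) + derivative tail
      ≈⟨ +-cong (trans (derivative-*B (A 0) (suc n)) (*-congʳ {B (suc n)} derivative-A-zero))
           (derivative-sum term) ⟩
    sum (λ i → derivative (term i))
      ≈⟨ sum-cong-≋ {suc n} (λ i → trans (derivative-*B (A (suc (toℕ i))) (n ∸ toℕ i))
           (trans (*-congʳ {B (n ∸ toℕ i)} (derivative-A-suc (toℕ i)))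
             (*-assoc Q (A (toℕ i) ∘ₚ shift u) (B (n ∸ toℕ i))))) ⟩
    sum (λ i → Q * term′ i)
      ≈⟨ *-distribˡ-sum Q term′ ⟨
    Q * sum term′
      ≈⟨ *-congˡ {Q} (⊛B-∘ₚ A n (shift u)) ⟨
    Q * ((A ⊛ B) n ∘ₚ shift u)
      ∎
    where
    term term′ : Fin (suc n) → Poly
    term i = A (suc (toℕ i)) * B (n ∸ toℕ i)
    term′ i = (A (toℕ i) ∘ₚ shift u) * B (n ∸ toℕ i)
    tail = sum term

  A⊛B-zero : (A ⊛ B) 0 ≈ 1#
  A⊛B-zero = begin
    A 0 * B 0 + 0#  ≈⟨ +-identityʳ (A 0 * B 0) ⟩
    A 0 * B 0       ≈⟨ *-cong A-zero (DAG-zero (constₚ (w F.* 1/[1+w]))) ⟩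
    1# * 1#         ≈⟨ *-identityˡ 1# ⟩
    1#              ∎

  sum-zero : ∀ {n} {f : Fin n → Poly} → (∀ i → f i ≈ 0#) → sum f ≈ 0#
  sum-zero {n} f≈0 = trans (sum-cong-≋ f≈0) (sum-replicate-zero n)

  -- At u = 0 the series `A` becomes 1, so that only the leading term of the convolution survives.
  A⊛B-∘ₚ-0 : ∀ n → (A ⊛ B) (suc n) ∘ₚ 0# ≈ B (suc n)
  A⊛B-∘ₚ-0 n = begin
    (A ⊛ B) (suc n) ∘ₚ 0#
      ≈⟨ ⊛B-∘ₚ A (suc n) 0# ⟩
    (A 0 ∘ₚ 0#) * B (suc n) + sum {suc n} (λ i → (A (suc (toℕ i)) ∘ₚ 0#) * B (n ∸ toℕ i))
      ≈⟨ +-cong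
           (trans (*-congʳ {B (suc n)} (trans (∘ₚ-cong 0# A-zero) (constₚ-∘ₚ F.1# 0#))) (*-identityˡ (B (suc n))))
           (sum-zero {suc n} (λ i → *-congʳ {B (n ∸ toℕ i)} (A-suc-0 (toℕ i)))) ⟩
    B (suc n) + 0#
      ≈⟨ +-identityʳ (B (suc n)) ⟩
    B (suc n)
      ∎

  DAG-shift : ∀ n → DAG (shift u) n ≈ (A ⊛ B) n
  DAG-shift zero    = trans (DAG-zero (shift u)) (sym A⊛B-zero)
  DAG-shift (suc n) = derivative-injective derivatives constants
    where
    derivatives : derivative (DAG (shift u) (suc n)) ≈ derivative ((A ⊛ B) (suc n))
    derivatives = begin
      derivative (DAG (shift u) (suc n))
        ≈⟨ derivative-DAG-suc (shift u) n ⟩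
      derivative (shift u) * DAG (shift (shift u)) n
        ≈⟨ *-congʳ {DAG (shift (shift u)) n} derivative-shift-u ⟩
      Q * DAG (shift (shift u)) n
        ≈⟨ *-congˡ {Q} (DAG-cong n (trans (shift-∘ₚ u (shift u)) (+-congˡ {constₚ (w F.* 1/[1+w])}
             (*-congˡ {Q} (X-∘ₚ (shift u)))))) ⟨
      Q * DAG (shift u ∘ₚ shift u) n
        ≈⟨ *-congˡ {Q} (DAG-∘ₚ (shift u) n (shift u)) ⟨
      Q * (DAG (shift u) n ∘ₚ shift u)
        ≈⟨ *-congˡ {Q} (∘ₚ-cong (shift u) (DAG-shift n)) ⟩
      Q * ((A ⊛ B) n ∘ₚ shift u)
        ≈⟨ derivative-A⊛B-suc n ⟨
      derivative ((A ⊛ B) (suc n))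
        ∎

    constants : DAG (shift u) (suc n) ∘ₚ 0# ≈ (A ⊛ B) (suc n) ∘ₚ 0#
    constants = begin
      DAG (shift u) (suc n) ∘ₚ 0#
        ≈⟨ DAG-∘ₚ (shift u) (suc n) 0# ⟩
      DAG (shift u ∘ₚ 0#) (suc n)
        ≈⟨ DAG-cong (suc n) (trans (shift-∘ₚ u 0#) (trans (+-congˡ {constₚ (w F.* 1/[1+w])}
             (trans (*-congˡ {Q} (X-∘ₚ 0#)) (zeroʳ Q))) (+-identityʳ (constₚ (w F.* 1/[1+w]))))) ⟩
      B (suc n)
        ≈⟨ A⊛B-∘ₚ-0 n ⟨
      (A ⊛ B) (suc n) ∘ₚ 0#
        ∎

  -- Convolution with constants and with z

  constant-⊛ : ∀ a f n → (constant a ⊛ f) n ≈ a * f n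
  constant-⊛ a f n = trans (+-congˡ {a * f n} (sum-zero {n} (λ i → zeroˡ (f (n ∸ suc (toℕ i))))))
    (+-identityʳ (a * f n))

  ⊛-congʳ : ∀ {f g} h → (∀ n → f n ≈ g n) → ∀ n → (f ⊛ h) n ≈ (g ⊛ h) n
  ⊛-congʳ h f≈g n = sum-cong-≋ {suc n} λ i → *-congʳ {h (n ∸ toℕ i)} (f≈g (toℕ i))

  -- The product `constant a ⊛ z` in closed form: `_⊛_` associates to the left, so in the theorem
  -- `constant u` meets `z` first.
  linear : Poly → Series
  linear a zero          = 0#
  linear a (suc zero)    = a
  linear a (suc (suc _)) = 0#

  constant-⊛-z : ∀ a n → (constant a ⊛ z) n ≈ linear a n
  constant-⊛-z a n = trans (constant-⊛ a z n) (lemma n)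
    where
    lemma : ∀ n → a * z n ≈ linear a n
    lemma zero          = zeroʳ a
    lemma (suc zero)    = *-identityʳ a
    lemma (suc (suc n)) = zeroʳ a

  -- The series a z f.
  shifted : Poly → Series → Series
  shifted a f zero    = 0#
  shifted a f (suc n) = a * f n

  linear-⊛ : ∀ a f n → (linear a ⊛ f) n ≈ shifted a f n
  linear-⊛ a f zero    = refl
  linear-⊛ a f (suc n) = trans (+-congˡ {a * f n} (sum-zero {n} (λ i → zeroˡ (f (n ∸ suc (toℕ i))))))
    (+-identityʳ (a * f n))

  -- The instance of associativity of `_⊛_` that the theorem calls for: a factor a z moves out of a
  -- product.
  shifted-⊛ : ∀ a f g n → (shifted a f ⊛ g) n ≈ shifted a (f ⊛ g) n
  shifted-⊛ a f g zero    = refl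
  shifted-⊛ a f g (suc n) = trans
    (sum-cong-≋ {suc n} (λ i → *-assoc a (f (toℕ i)) (g (n ∸ toℕ i))))
    (sym (*-distribˡ-sum {suc n} a (λ i → f (toℕ i) * g (n ∸ toℕ i))))

  u∂ᵤDAG : ∀ n → (constant u ⊛ ∂ᵤ (DAG u)) n ≈ shifted u (A ⊛ B) n
  u∂ᵤDAG n = trans (constant-⊛ u (∂ᵤ (DAG u)) n) (lemma n)
    where
    lemma : ∀ n → u * derivative (DAG u n) ≈ shifted u (A ⊛ B) n
    -- The empty DAG has no source, so the constant term in z does not involve `u`.
    lemma zero    = trans (*-congˡ {u} (derivative-cong (DAG-zero u))) (zeroʳ u)
    lemma (suc n) = *-congˡ {u} (begin
      derivative (DAG u (suc n))       ≈⟨ derivative-DAG-suc u n ⟩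
      derivative u * DAG (shift u) n   ≈⟨ *-congʳ {DAG (shift u) n} derivative-u ⟩
      1# * DAG (shift u) n             ≈⟨ *-identityˡ (DAG (shift u) n) ⟩
      DAG (shift u) n                  ≈⟨ DAG-shift n ⟩
      (A ⊛ B) n                        ∎)

  source-identity : ∀ n → (constant u ⊛ ∂ᵤ (DAG u)) n ≈ (constant u ⊛ z ⊛ A ⊛ B) n
  source-identity n = begin
    (constant u ⊛ ∂ᵤ (DAG u)) n     ≈⟨ u∂ᵤDAG n ⟩
    shifted u (A ⊛ B) n             ≈⟨ shifted-⊛ u A B n ⟨
    (shifted u A ⊛ B) n             ≈⟨ ⊛-congʳ B (linear-⊛ u A) n ⟨
    (linear u ⊛ A ⊛ B) n                ≈⟨ ⊛-congʳ B (⊛-congʳ A (constant-⊛-z u)) n ⟨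
    (constant u ⊛ z ⊛ A ⊛ B) n      ∎

theorem2 : ∀ {c ℓ₁ ℓ₂ ℓ₃} (F : OrderedField c ℓ₁ ℓ₂ ℓ₃) → let open OrderedField F in
    (w : Carrier) (0<w : 0# < w) → let open GraphicGeneratingFunction F w 0<w in
    constant u ⊛ ∂ᵤ (DAG u)
      ≋ constant u ⊛ z ⊛ (DAG u ⟨ constₚ 1/[1+w] z⟩) ⊛ DAG (constₚ (w * 1/[1+w]))
theorem2 F w 0<w n = source-identity n .at
  where
  open DAGSeries F w 0<w
  open PolynomialSemiring (OrderedField.commutativeRing F) using (_≅_)
  open _≅_
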